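{- For every positive integer $n$ the following four inequalities hold: $$g_1(n|_2) \leq \lceil \log_3 n \rceil + \lceil \log_3(n/5) \rceil + 1,$$ $$g_1(n|_3) \leq \lceil \log_3 n \rceil + \lceil \log_3(n/4) \rceil + \lceil \log_3(n/6) \rceil + 2,$$ $$g_1(n|_4) \leq \lceil \log_3 n \rceil + \lceil \log_3(n/5) \rceil + \lceil \log_3(n/11) \rceil + \lceil \log_3(n/20) \rceil + 5,$$ $$g_1(n|_5) \leq \lceil \log_3 n \rceil + \lceil \log_3(n/7) \rceil + \lceil \log_3(n/11) \rceil + \lceil \log_3(n/13) \rceil + \lceil \log_3(n/17) \rceil + 7.$$
   Context: Let $S_1,\dots,S_m$ be pairwise disjoint finite sets of coins with $|S_i|=n_i\ge 1$. Each $S_i$ contains exactly one counterfeit coin. All normal coins have the same weight, and all counterfeit coins have the same weight, heavier than that of a normal coin. The unknown configuration is thus an element $X$ of $S_1\times\cdots\times S_m$ (identified with the set of its $m$ counterfeit coins). A weighing $L:R$ on a balance consists of two subsets $L,R\subset \bigcup_{i=1}^m S_i$ with $|L|=|R|$ (coins from different $S_i$ may be mixed), and its outcome is $\operatorname{sgn}(|L\cap X|-|R\cap X|)\in\{+,0,-\}$. A search algorithm is adaptive: each weighing may depend on the outcomes of all previous weighings. Define $g_1(n_1,\dots,n_m)$ to be the least number $t$ such that some adaptive algorithm using at most $t$ weighings always identifies all $m$ counterfeit coins, i.e. the sequence of outcomes determines $X\in S_1\times\cdots\times S_m$ uniquely. When $n_1=\cdots=n_m=n$, write $g_1(n|_m)$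 for $g_1(n_1,\dots,n_m)$. $\lceil x\rceil$ denotes the least integer not less than the real number $x$ (it may be negative). -}

module Defs where

open import Data.Fin.Base using (Fin)
import Data.Fin.Properties as Fin
open import Data.Fin.Subset using (Subset; ⁅_⁆) renaming (⊥ to ∅; _∩_ to _∩ₛ_; ∣_∣ to ∣_∣ₛ)
import Data.Fin.Subset.Properties as Subset
open import Data.Integer.Base using (ℤ; +_; -[1+_]; +0; +[1+_]; _⊖_)
import Data.Integer.Base as ℤ
import Data.Integer.Properties as ℤ
open import Data.List.Base using (List; []; _∷_; _++_; map; cartesianProductWith; allFin; length)
open import Data.List.Properties using (∷-injective)
open import Data.List.Membership.Propositional using (_∈_)
import Data.List.Membership.Propositional.Properties as ∈
open import Data.List.Relation.Unary.Any using (here; there)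
open import Data.Nat.Base hiding (compare; _/_)
open import Data.Nat.Properties using
  (_≟_; _≤?_; *-comm; *-assoc; *-identityʳ; *-cancelʳ-≤; *-monoˡ-≤; +-mono-≤;
   +-monoʳ-≤; ^-distribˡ-+-*; ≤-trans; ≡-irrelevant; m^n>0; m≤m+n; m≤n+m;
   m≤n*m; m+n∸n≡m; m∸n≤m; m∸[m∸n]≡n; module ≤-Reasoning)
open import Data.Product.Base using (Σ-syntax; ∃; ∃-syntax; _×_; _,_; proj₁; proj₂; uncurry)
open import Data.Unit.Base using (⊤; tt)
open import Data.Vec.Base using (Vec; []; _∷_; sum)
open import Data.Vec.Relation.Unary.All as All using (All; []; _∷_)
open import Function.Base using (_∘_)
open import Relation.Binary.Definitions using (DecidableEquality)
open import Relation.Binary.PropositionalEquality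
open import Relation.Nullary.Decidable using (Dec; yes; no; map′; _×-dec_; _→-dec_)
open import Relation.Nullary.Negation using (¬_; contradiction)
open import Relation.Unary using (Decidable)

private
  variable
    m n t : ℕ
    ns : Vec ℕ m

Least : (ℕ → Set) → ℕ → Set
Least P t = P t × (∀ s → P s → t ≤ s)

least : {P : ℕ → Set} → Decidable P → ∀ b → P b → ∃ (Least P)
least P? b pb with P? 0
... | yes p0 = 0 , p0 , λ _ _ → z≤n
least P? zero pb | no ¬p0 = contradiction pb ¬p0
least {P} P? (suc b) pb | no ¬p0 with least (P? ∘ suc) b pb
... | t , pt , t≤ = suc t , pt , λ where
  zero    p → contradiction p ¬p0
  (suc s) p → s≤s (t≤ s p)

-- n/d ≤ 3^z (equivalently log₃ (n/d) ≤ z), with denominators cleared.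
_/_≤3^_ : ℕ → ℕ → ℤ → Set
n / d ≤3^ (+ k)    = n ≤ d * 3 ^ k
n / d ≤3^ -[1+ k ] = n * 3 ^ suc k ≤ d

private
  *3^suc : ∀ n k → n * 3 ^ suc k ≡ (n * 3 ^ k) * 3
  *3^suc n k = trans (cong (n *_) (*-comm 3 (3 ^ k))) (sym (*-assoc n (3 ^ k) 3))

  ⊖⁺ : ∀ n d a b → n * 3 ^ b ≤ d * 3 ^ a → n / d ≤3^ (a ⊖ b)
  ⊖⁺ n d a       zero    h = subst (_≤ d * 3 ^ a) (*-identityʳ n) h
  ⊖⁺ n d zero    (suc b) h = subst (n * 3 ^ suc b ≤_) (*-identityʳ d) h
  ⊖⁺ n d (suc a) (suc b) h rewrite ℤ.[1+m]⊖[1+n]≡m⊖n a b =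
    ⊖⁺ n d a b (*-cancelʳ-≤ _ _ 3 (subst₂ _≤_ (*3^suc n b) (*3^suc d a) h))

  ⊖⁻ : ∀ n d a b → n / d ≤3^ (a ⊖ b) → n * 3 ^ b ≤ d * 3 ^ a
  ⊖⁻ n d a       zero    h = subst (_≤ d * 3 ^ a) (sym (*-identityʳ n)) h
  ⊖⁻ n d zero    (suc b) h = subst (n * 3 ^ suc b ≤_) (sym (*-identityʳ d)) h
  ⊖⁻ n d (suc a) (suc b) h rewrite ℤ.[1+m]⊖[1+n]≡m⊖n a b =
    subst₂ _≤_ (sym (*3^suc n b)) (sym (*3^suc d a)) (*-monoˡ-≤ 3 (⊖⁻ n d a b h))

  n≤3^n : ∀ n → n ≤ 3 ^ n
  n≤3^n zero    = z≤n
  n≤3^n (suc n) = ≤-trans (+-mono-≤ (m^n>0 3 n) (n≤3^n n))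
                          (+-monoʳ-≤ (3 ^ n) (m≤m+n (3 ^ n) _))

  numerator-bound : ∀ n d .{{_ : NonZero d}} → n * 3 ^ d ≤ d * 3 ^ (n + d)
  numerator-bound n d = begin
    n * 3 ^ d       ≤⟨ *-monoˡ-≤ (3 ^ d) (n≤3^n n) ⟩
    3 ^ n * 3 ^ d   ≡⟨ ^-distribˡ-+-* 3 n d ⟨
    3 ^ (n + d)     ≤⟨ m≤n*m (3 ^ (n + d)) d ⟩
    d * 3 ^ (n + d) ∎
    where open ≤-Reasoning

  shift : ∀ n d .{{_ : NonZero n}} z → n / d ≤3^ z → ∃[ a ] z ≡ a ⊖ d
  shift n d (+ k) _ = k + d , sym (trans (ℤ.⊖-≥ (m≤n+m d k)) (cong +_ (m+n∸n≡m k d)))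
  shift n d -[1+ k ] h = d ∸ suc k , sym (begin
    (d ∸ suc k) ⊖ d            ≡⟨ ℤ.⊖-≤ (m∸n≤m d (suc k)) ⟩
    ℤ.- (+ (d ∸ (d ∸ suc k)))  ≡⟨ cong (λ x → ℤ.- (+ x)) (m∸[m∸n]≡n 1+k≤d) ⟩
    -[1+ k ]                   ∎)
    where
    open ≡-Reasoning
    1+k≤d : suc k ≤ d
    1+k≤d = ≤-trans (n≤3^n (suc k)) (≤-trans (m≤n*m (3 ^ suc k) n) h)

  -- ⌈log₃ (n/d)⌉ ≥ -d, so a search over the naturals shifted by d suffices.
  log₃-search : ∀ n d .{{_ : NonZero d}} → ∃ (Least λ a → n * 3 ^ d ≤ d * 3 ^ a)
  log₃-search n d = least (λ a → n * 3 ^ d ≤? d * 3 ^ a) (n + d) (numerator-bound n d)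

⌈log₃_/_⌉ : (n d : ℕ) .{{_ : NonZero n}} .{{_ : NonZero d}} → ℤ
⌈log₃ n / d ⌉ = proj₁ (log₃-search n d) ⊖ d

⌈log₃⌉-upper : ∀ n d .{{_ : NonZero n}} .{{_ : NonZero d}} → n / d ≤3^ ⌈log₃ n / d ⌉
⌈log₃⌉-upper n d = ⊖⁺ n d _ d (proj₁ (proj₂ (log₃-search n d)))

⌈log₃⌉-least : ∀ n d .{{_ : NonZero n}} .{{_ : NonZero d}} z →
               n / d ≤3^ z → ⌈log₃ n / d ⌉ ℤ.≤ z
⌈log₃⌉-least n d z h with shift n d z h
... | a , refl = ℤ.⊖-monoˡ-≤ d (proj₂ (proj₂ (log₃-search n d)) a (⊖⁻ n d a d h))

-- The set S_i is Fin n_i. A set of coins S ⊆ ⋃ S_i is given by its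
-- intersections with the disjoint sets S_i.
CoinSet : Vec ℕ m → Set
CoinSet = All Subset

Configuration : Vec ℕ m → Set
Configuration = All Fin

infixr 7 _∩_
_∩_ : CoinSet ns → CoinSet ns → CoinSet ns
S ∩ T = All.map (uncurry _∩ₛ_) (All.zip (S , T))

∣_∣ : CoinSet ns → ℕ
∣ S ∣ = sum (All.reduce ∣_∣ₛ S)

counterfeits : Configuration ns → CoinSet ns
counterfeits = All.map ⁅_⁆

record Weighing (ns : Vec ℕ m) : Set where
  constructor weighing
  field
    left right : CoinSet ns
    balanced   : ∣ left ∣ ≡ ∣ right ∣

open Weighing public

data Outcome : Set where
  ⊕ ⊙ ⊝ : Outcome

sgn : ℤ → Outcome
sgn +[1+ _ ] = ⊕
sgn +0       = ⊙
sgn -[1+ _ ] = ⊝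

outcome : Weighing ns → Configuration ns → Outcome
outcome w X = sgn (∣ left w ∩ counterfeits X ∣ ⊖ ∣ right w ∩ counterfeits X ∣)

-- Adaptive algorithms using at most t weighings (stop is available at every t).
data Algorithm (ns : Vec ℕ m) : ℕ → Set where
  stop  : Algorithm ns t
  weigh : Weighing ns → (Outcome → Algorithm ns t) → Algorithm ns (suc t)

outcomes : Algorithm ns t → Configuration ns → List Outcome
outcomes stop        X = []
outcomes (weigh w A) X = outcome w X ∷ outcomes (A (outcome w X)) X

Identifies : Algorithm ns t → Set
Identifies A = ∀ X Y → outcomes A X ≡ outcomes A Y → X ≡ Y

Solvable : Vec ℕ m → ℕ → Set
Solvable ns t = Σ[ A ∈ Algorithm ns t ] Identifies A

private
  any-coinSet? : {P : CoinSet ns → Set} → Decidable P → Dec (∃ P)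
  any-coinSet? {ns = []} P? = map′ ([] ,_) (λ { ([] , p) → p }) (P? [])
  any-coinSet? {ns = n ∷ ns} P? =
    map′ (λ (s , S , p) → s ∷ S , p) (λ { (s ∷ S , p) → s , S , p })
         (Subset.anySubset? λ s → any-coinSet? λ S → P? (s ∷ S))

  all-configuration? : {P : Configuration ns → Set} → Decidable P → Dec (∀ X → P X)
  all-configuration? {ns = []} P? = map′ (λ { p [] → p }) (λ p → p []) (P? [])
  all-configuration? {ns = n ∷ ns} P? =
    map′ (λ { p (x ∷ X) → p x X }) (λ p x X → p (x ∷ X))
         (Fin.all? λ x → all-configuration? λ X → P? (x ∷ X))

  any-weighing? : {P : Weighing ns → Set} → Decidable P → Dec (∃ P)
  any-weighing? {P = P} P? =
    map′ (λ (L , R , e , p) → weighing L R e , p)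
         (λ (w , p) → left w , right w , balanced w , p)
         (any-coinSet? λ L → any-coinSet? λ R → dec L R)
    where
    dec : ∀ L R → Dec (Σ[ e ∈ ∣ L ∣ ≡ ∣ R ∣ ] P (weighing L R e))
    dec L R with ∣ L ∣ ≟ ∣ R ∣
    ... | no ¬e = no λ (e , _) → ¬e e
    ... | yes e = map′ (e ,_)
      (λ (e′ , p) → subst (λ e → P (weighing L R e)) (≡-irrelevant e′ e) p)
      (P? (weighing L R e))

  all-outcome? : {P : Outcome → Set} → Decidable P → Dec (∀ o → P o)
  all-outcome? P? =
    map′ (λ { (a , b , c) ⊕ → a ; (a , b , c) ⊙ → b ; (a , b , c) ⊝ → c })
         (λ p → p ⊕ , p ⊙ , p ⊝)
         (P? ⊕ ×-dec P? ⊙ ×-dec P? ⊝)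

  _≟ᵒ_ : DecidableEquality Outcome
  ⊕ ≟ᵒ ⊕ = yes refl
  ⊕ ≟ᵒ ⊙ = no λ ()
  ⊕ ≟ᵒ ⊝ = no λ ()
  ⊙ ≟ᵒ ⊕ = no λ ()
  ⊙ ≟ᵒ ⊙ = yes refl
  ⊙ ≟ᵒ ⊝ = no λ ()
  ⊝ ≟ᵒ ⊕ = no λ ()
  ⊝ ≟ᵒ ⊙ = no λ ()
  ⊝ ≟ᵒ ⊝ = yes refl

  _≟ᶜ_ : DecidableEquality (Configuration ns)
  [] ≟ᶜ [] = yes refl
  (x ∷ X) ≟ᶜ (y ∷ Y) =
    map′ (λ { (refl , refl) → refl }) (λ { refl → refl , refl }) (x Fin.≟ y ×-dec X ≟ᶜ Y)

  SolvableOn : (Configuration ns → Set) → ℕ → Set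
  SolvableOn {ns = ns} C t = Σ[ A ∈ Algorithm ns t ]
    (∀ X Y → C X → C Y → outcomes A X ≡ outcomes A Y → X ≡ Y)

  Trivial : (Configuration ns → Set) → Set
  Trivial C = ∀ X Y → C X → C Y → X ≡ Y

  trivial? : {C : Configuration ns → Set} → Decidable C → Dec (Trivial C)
  trivial? C? = all-configuration? λ X → all-configuration? λ Y →
    C? X →-dec C? Y →-dec X ≟ᶜ Y

  Splits : (Configuration ns → Set) → ℕ → Weighing ns → Set
  Splits C t w = ∀ o → SolvableOn (λ X → C X × outcome w X ≡ o) t

  weigh⁺ : {C : Configuration ns → Set} → ∃ (Splits C t) → SolvableOn C (suc t)
  weigh⁺ {t = t} {C = C} (w , s) = weigh w A , λ X Y cX cY eq →
    let e , es = ∷-injective eq in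
    proj₂ (s (outcome w X)) X Y (cX , refl) (cY , sym e)
      (trans es (cong (λ o → outcomes (A o) Y) (sym e)))
    where
    A : Outcome → Algorithm _ t
    A o = proj₁ (s o)

  weigh⁻ : {C : Configuration ns → Set} (w : Weighing ns) (A : Outcome → Algorithm ns t) →
           (∀ X Y → C X → C Y → outcomes (weigh w A) X ≡ outcomes (weigh w A) Y → X ≡ Y) →
           Splits C t w
  weigh⁻ w A h o = A o , λ X Y (cX , eX) (cY , eY) eq → h X Y cX cY
    (trans (run X eX) (trans (cong (o ∷_) eq) (sym (run Y eY))))
    where
    run : ∀ X → outcome w X ≡ o → outcomes (weigh w A) X ≡ o ∷ outcomes (A o) X
    run X refl = refl

  solvableOn? : {C : Configuration ns → Set} → Decidable C → ∀ t → Dec (SolvableOn C t)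
  solvableOn? C? zero =
    map′ (λ h → stop , λ X Y cX cY _ → h X Y cX cY)
         (λ { (stop , h) X Y cX cY → h X Y cX cY refl })
         (trivial? C?)
  solvableOn? {C = C} C? (suc t) with trivial? C?
  ... | yes h = yes (stop , λ X Y cX cY _ → h X Y cX cY)
  ... | no ¬h = map′ weigh⁺
    (λ { (stop , h)      → contradiction (λ X Y cX cY → h X Y cX cY refl) ¬h
       ; (weigh w A , h) → w , weigh⁻ w A h })
    (any-weighing? λ w → all-outcome? λ o →
      solvableOn? (λ X → C? X ×-dec outcome w X ≟ᵒ o) t)

solvable? : (ns : Vec ℕ m) → Decidable (Solvable ns)
solvable? ns t =
  map′ (λ (A , h) → A , λ X Y → h X Y tt tt)
       (λ (A , h) → A , λ X Y _ _ → h X Y)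
       (solvableOn? {C = λ _ → ⊤} (λ _ → yes tt) t)

private
  ∅s : CoinSet ns
  ∅s {ns = []}     = []
  ∅s {ns = n ∷ ns} = ∅ ∷ ∅s

  ∣∅∩S∣≡0 : (S : Subset n) → ∣ ∅ ∩ₛ S ∣ₛ ≡ 0
  ∣∅∩S∣≡0 {n} S = trans (cong ∣_∣ₛ (Subset.∩-zeroˡ S)) (Subset.∣⊥∣≡0 n)

  ∣∅s∩S∣≡0 : (S : CoinSet ns) → ∣ ∅s ∩ S ∣ ≡ 0
  ∣∅s∩S∣≡0 []      = refl
  ∣∅s∩S∣≡0 (s ∷ S) = cong₂ _+_ (∣∅∩S∣≡0 s) (∣∅s∩S∣≡0 S)

  ∣⁅x⁆∩⁅x⁆∣≡1 : (x : Fin n) → ∣ ⁅ x ⁆ ∩ₛ ⁅ x ⁆ ∣ₛ ≡ 1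
  ∣⁅x⁆∩⁅x⁆∣≡1 x = trans (cong ∣_∣ₛ (Subset.∩-idem ⁅ x ⁆)) (Subset.∣⁅x⁆∣≡1 x)

  ∣⁅x⁆∩⁅y⁆∣≡0 : {x y : Fin n} → x ≢ y → ∣ ⁅ x ⁆ ∩ₛ ⁅ y ⁆ ∣ₛ ≡ 0
  ∣⁅x⁆∩⁅y⁆∣≡0 {n} {x} {y} x≢y =
    trans (cong ∣_∣ₛ (Subset.Empty-unique λ (z , z∈) →
            let z∈x , z∈y = Subset.x∈p∩q⁻ ⁅ x ⁆ ⁅ y ⁆ z∈ in
            x≢y (trans (sym (Subset.x∈⁅y⁆⇒x≡y x z∈x)) (Subset.x∈⁅y⁆⇒x≡y y z∈y))))
          (Subset.∣⊥∣≡0 n)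

  compare : Fin n → Fin n → Weighing (n ∷ ns)
  compare i j = weighing (⁅ i ⁆ ∷ ∅s) (⁅ j ⁆ ∷ ∅s)
    (cong (_+ _) (trans (Subset.∣⁅x⁆∣≡1 i) (sym (Subset.∣⁅x⁆∣≡1 j))))

  extend : Weighing ns → Weighing (n ∷ ns)
  extend {n = n} (weighing L R e) = weighing (∅ ∷ L) (∅ ∷ R) (cong (λ k → ∣ ∅ {n} ∣ₛ + k) e)

  outcome-compareˡ : {x y : Fin n} (X : Configuration ns) → y ≢ x → outcome (compare x y) (x ∷ X) ≡ ⊕
  outcome-compareˡ {x = x} X y≢x
    rewrite ∣⁅x⁆∩⁅x⁆∣≡1 x | ∣⁅x⁆∩⁅y⁆∣≡0 y≢x | ∣∅s∩S∣≡0 (counterfeits X) = refl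

  outcome-compareʳ : {x y : Fin n} (Y : Configuration ns) → x ≢ y → outcome (compare x y) (y ∷ Y) ≡ ⊝
  outcome-compareʳ {y = y} Y x≢y
    rewrite ∣⁅x⁆∩⁅x⁆∣≡1 y | ∣⁅x⁆∩⁅y⁆∣≡0 x≢y | ∣∅s∩S∣≡0 (counterfeits Y) = refl

  outcome-extend : (w : Weighing ns) (x : Fin n) (X : Configuration ns) →
                   outcome (extend w) (x ∷ X) ≡ outcome w X
  outcome-extend w x X rewrite ∣∅∩S∣≡0 ⁅ x ⁆ = refl

  -- Comparing all pairs of coins within each S_i identifies the configuration,
  -- so some number of weighings suffices and the minimum g₁ exists.
  comparisons : (ns : Vec ℕ m) → List (Weighing ns)
  comparisons []       = []
  comparisons (n ∷ ns) =
    cartesianProductWith compare (allFin n) (allFin n) ++ map extend (comparisons ns)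

  separate : (X Y : Configuration ns) →
             (∀ {w} → w ∈ comparisons ns → outcome w X ≡ outcome w Y) → X ≡ Y
  separate [] [] _ = refl
  separate {ns = n ∷ ns} (x ∷ X) (y ∷ Y) h = cong₂ _∷_ x≡y (separate X Y λ {w} w∈ →
      trans (sym (outcome-extend w x X))
        (trans (h (∈.∈-++⁺ʳ (cartesianProductWith compare (allFin n) (allFin n)) (∈.∈-map⁺ extend w∈)))
               (outcome-extend w y Y)))
    where
    x≡y : x ≡ y
    x≡y with x Fin.≟ y
    ... | yes e = e
    ... | no x≢y = contradiction
      (trans (sym (outcome-compareˡ X (x≢y ∘ sym)))
        (trans (h (∈.∈-++⁺ˡ (∈.∈-cartesianProductWith⁺ compare (∈.∈-allFin x) (∈.∈-allFin y))))
               (outcome-compareʳ Y x≢y)))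
      λ ()

  runAll : (ws : List (Weighing ns)) → Algorithm ns (length ws)
  runAll []       = stop
  runAll (w ∷ ws) = weigh w λ _ → runAll ws

  runAll-outcomes : (ws : List (Weighing ns)) {w : Weighing ns} → ∀ X Y →
    outcomes (runAll ws) X ≡ outcomes (runAll ws) Y → w ∈ ws → outcome w X ≡ outcome w Y
  runAll-outcomes (w ∷ ws) X Y eq (here refl) = proj₁ (∷-injective eq)
  runAll-outcomes (w ∷ ws) X Y eq (there w∈)  = runAll-outcomes ws X Y (proj₂ (∷-injective eq)) w∈

  solvable : (ns : Vec ℕ m) → Solvable ns (length (comparisons ns))
  solvable ns = runAll (comparisons ns) , λ X Y eq →
    separate X Y (runAll-outcomes (comparisons ns) X Y eq)

  g₁-search : (ns : Vec ℕ m) → ∃ (Least (Solvable ns))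
  g₁-search ns = least (solvable? ns) (length (comparisons ns)) (solvable ns)

g₁ : Vec ℕ m → ℕ
g₁ ns = proj₁ (g₁-search ns)

g₁-solvable : (ns : Vec ℕ m) → Solvable ns (g₁ ns)
g₁-solvable ns = proj₁ (proj₂ (g₁-search ns))

g₁-least : (ns : Vec ℕ m) → ∀ t → Solvable ns t → g₁ ns ≤ t
g₁-least ns = proj₂ (proj₂ (g₁-search ns))

{-# OPTIONS --safe #-}

-- Weighing one third of a pile against another third, once for each of the m piles,
-- reduces n coins per pile to at most ⌈n/3⌉ candidates per pile. From then on at
-- least as many coins are known to be normal as are not, so every algorithm for
-- N ≥ n/3 coins per pile can be simulated on the candidates, using normal coins to
-- equalize the pans. Hence the minimum for n exceeds the one for ⌈n/3⌉ by at most m,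
-- whereas each claimed bound grows by m if n is larger than all denominators. The
-- remaining n follow, partly by tripling again, from explicit strategies for twenty
-- small cases. These were found by a computer search; they are manageable because
-- coins that play the same role can be identified, so that few states occur.
module Submission where

open import Defs

-- The additive constants make each bound 0 at `n = 1`. If `n > d`, the least threshold `d * 3 ^ k`
-- that is at least `n` has `k ≥ 1` and is a multiple of 3, so rounding `n/3` up does not pass the
-- next lower threshold and the logarithm drops by at least one. If `n ≤ d`, the lower threshold
-- need not be an integer and rounding may pass it: `⌈log₃ n / 11 ⌉` is 0 at 10 and still 0 at 4.
-- This loss is why tripling alone fails for small `n`. Nor does the simulation turn a strategy for
-- 5 coins per pile into one for 4: no coin is known to be normal at the start, so neighbouring
-- sizes with the same bound may each require a strategy. The certificates contain only weighings;
-- the states that these lead to are computed by the check itself, so nothing about the search has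
-- to be trusted. The number `g₁` is defined by exhaustive search and hence enters only through
-- `g₁-solvable` and `g₁-least`.

module Strategies where

  open import Defs
  open import Data.Bool.Base using (Bool; true; false; _∧_; if_then_else_; T)
  import Data.Bool.Properties as Bool
  open import Data.Char.Base using (toℕ)
  open import Data.Fin.Base using (Fin; zero; suc)
  open import Data.Fin.Subset using (Subset; ⁅_⁆; inside; outside) renaming (∣_∣ to ∣_∣ₛ; _∩_ to _∩ₛ_)
  import Data.Fin.Subset.Properties as Subset
  open import Data.Integer.Base using (ℤ; -[1+_]; _⊖_)
  import Data.Integer.Base as ℤ
  import Data.Integer.Properties as ℤ
  open import Data.List.Base as List using
    (List; []; _∷_; cartesianProductWith; concatMap; deduplicate; filter; foldr; length; upTo)
  import Data.List.Properties as List
  open import Data.List.Membership.Propositional using (_∈_; lose)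
  import Data.List.Membership.Propositional.Properties as ∈
  open import Data.List.Relation.Binary.Permutation.Propositional using (_↭_; ↭-sym; ↭-trans; ↭-reflexive)
  import Data.List.Relation.Binary.Permutation.Propositional.Properties as ↭
  open import Data.List.Relation.Unary.All using ([]; _∷_)
  import Data.List.Relation.Unary.All as ListAll
  open import Data.List.Relation.Unary.Any using (here; there; any?)
  open import Data.Nat.Base hiding (_/_; _%_)
  open import Data.Nat.DivMod using (_%_)
  open import Data.Nat.Induction using (<-rec)
  open import Data.Nat.ListAction using () renaming (sum to Σ)
  open import Data.Nat.ListAction.Properties using (sum-↭)
  open import Data.Nat.Properties
  open import Data.List.Sort.InsertionSort.Base ≤-decTotalOrder using (sort)
  open import Data.List.Sort.InsertionSort.Properties ≤-decTotalOrder using (sort-↭)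
  open import Data.Product using (Σ-syntax; ∃-syntax; _×_; _,_; proj₁; proj₂)
  open import Data.String.Base using (String; toList)
  open import Data.Sum using (inj₁; inj₂)
  open import Data.Unit.Base using (⊤; tt)
  open import Data.Vec.Base as Vec using (Vec; []; _∷_; lookup; replicate)
  import Data.Vec.Properties as Vec
  open import Data.Vec.Relation.Binary.Pointwise.Inductive using (Pointwise; []; _∷_)
  open import Data.Vec.Relation.Unary.All as All using (All; []; _∷_)
  open import Function.Base using (_∘_)
  open import Relation.Binary.Definitions using (DecidableEquality)
  open import Relation.Binary.PropositionalEquality
  open import Relation.Nullary.Decidable using (yes; no; does; map′; _×-dec_; True; toWitness)
  open import Relation.Nullary.Negation using (contradiction)

  private
    variable
      A B : Set
      k m n N t : ℕ
      ns Ns : Vec ℕ m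

  -- Restricted sets of configurations, and outcomes in terms of labels

  SolvableOn : (Configuration ns → Set) → ℕ → Set
  SolvableOn {ns = ns} C t = Σ[ A ∈ Algorithm ns t ]
    (∀ X Y → C X → C Y → outcomes A X ≡ outcomes A Y → X ≡ Y)

  solvableOn-⊆ : {C D : Configuration ns → Set} →
                 (∀ X → C X → D X) → SolvableOn D t → SolvableOn C t
  solvableOn-⊆ C⊆D (A , h) = A , λ X Y cX cY → h X Y (C⊆D X cX) (C⊆D Y cY)

  weigh-on : {C : Configuration ns → Set} (w : Weighing ns) →
             (∀ o → SolvableOn (λ X → C X × outcome w X ≡ o) t) → SolvableOn C (suc t)
  weigh-on w s = weigh w (proj₁ ∘ s) , λ X Y cX cY eq →
    let e , es = List.∷-injective eq in
    proj₂ (s (outcome w X)) X Y (cX , refl) (cY , sym e)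
      (trans es (cong (λ o → outcomes (proj₁ (s o)) Y) (sym e)))

  -- The weighings of the thirds are fixed in advance, so a branch can be named by the whole vector
  -- of their outcomes.
  weigh-all : {C : Configuration ns → Set} (ws : Vec (Weighing ns) m) →
              (∀ os → SolvableOn (λ X → C X × Vec.map (λ w → outcome w X) ws ≡ os) t) →
              SolvableOn C (m + t)
  weigh-all []       s = solvableOn-⊆ (λ X c → c , refl) (s [])
  weigh-all (w ∷ ws) s = weigh-on w λ o → weigh-all ws λ os →
    solvableOn-⊆ (λ { X ((c , e) , es) → c , cong₂ _∷_ e es }) (s (o ∷ os))

  -- One notion for several uses: a coin set labels coins by `Bool`, a placement by `Outcome`, a
  -- state of the search by numbers or kinds. Maps between labels translate one into another.
  labels : {ns : Vec ℕ m} → All (Vec A) ns → Configuration ns → Vec A m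
  labels []       []      = []
  labels (v ∷ vs) (x ∷ X) = lookup v x ∷ labels vs X

  labels-map : (f : A → B) (vs : All (Vec A) ns) (X : Configuration ns) →
               labels (All.map (Vec.map f) vs) X ≡ Vec.map f (labels vs X)
  labels-map f []       []      = refl
  labels-map f (v ∷ vs) (x ∷ X) = cong₂ _∷_ (Vec.lookup-map x f v) (labels-map f vs X)

  ∣p∩⁅x⁆∣ : (p : Subset n) (x : Fin n) (bs : Subset m) →
            ∣ p ∩ₛ ⁅ x ⁆ ∣ₛ + ∣ bs ∣ₛ ≡ ∣ lookup p x ∷ bs ∣ₛ
  ∣p∩⁅x⁆∣ {n = suc n} (b ∷ p) zero bs rewrite Subset.∩-zeroʳ p | Subset.∣⊥∣≡0 n with b
  ... | true  = refl
  ... | false = refl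
  ∣p∩⁅x⁆∣ (true  ∷ p) (suc x) bs = ∣p∩⁅x⁆∣ p x bs
  ∣p∩⁅x⁆∣ (false ∷ p) (suc x) bs = ∣p∩⁅x⁆∣ p x bs

  ∣S∩counterfeits∣ : (S : CoinSet ns) (X : Configuration ns) →
                     ∣ S ∩ counterfeits X ∣ ≡ ∣ labels S X ∣ₛ
  ∣S∩counterfeits∣ []      []      = refl
  ∣S∩counterfeits∣ (p ∷ S) (x ∷ X) =
    trans (cong (∣ p ∩ₛ ⁅ x ⁆ ∣ₛ +_) (∣S∩counterfeits∣ S X)) (∣p∩⁅x⁆∣ p x (labels S X))

  -- In each pile a pan meets the single counterfeit coin in 0 or 1 coins, so only the membership of
  -- the coins of `X` in the pans matters. Later arguments use outcomes in this form alone.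
  outcome-labels : (w : Weighing ns) (X : Configuration ns) →
                   outcome w X ≡ sgn (∣ labels (left w) X ∣ₛ ⊖ ∣ labels (right w) X ∣ₛ)
  outcome-labels w X =
    cong₂ (λ i j → sgn (i ⊖ j)) (∣S∩counterfeits∣ (left w) X) (∣S∩counterfeits∣ (right w) X)

  _==_ : Outcome → Outcome → Bool
  ⊕ == ⊕ = true
  ⊙ == ⊙ = true
  ⊝ == ⊝ = true
  _ == _ = false

  -- A weighing with disjoint pans is given by the pan of each coin:
  -- ⊕ for the left one, ⊝ for the right one and ⊙ for coins put aside.
  Placement : Vec ℕ m → Set
  Placement = All (Vec Outcome)

  pan : Outcome → Placement ns → CoinSet ns
  pan o = All.map (Vec.map (o ==_))

  #[_] : Outcome → Vec Outcome n → ℕ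
  #[ o ] v = ∣ Vec.map (o ==_) v ∣ₛ

  tally : Vec Outcome m → Outcome
  tally os = sgn (#[ ⊕ ] os ⊖ #[ ⊝ ] os)

  place : (a : Placement ns) → ∣ pan ⊕ a ∣ ≡ ∣ pan ⊝ a ∣ → Weighing ns
  place a = weighing (pan ⊕ a) (pan ⊝ a)

  outcome-place : (a : Placement ns) (e : ∣ pan ⊕ a ∣ ≡ ∣ pan ⊝ a ∣) (X : Configuration ns) →
                  outcome (place a e) X ≡ tally (labels a X)
  outcome-place a e X = trans (outcome-labels (place a e) X)
    (cong₂ (λ S T → sgn (∣ S ∣ₛ ⊖ ∣ T ∣ₛ)) (labels-map (⊕ ==_) a X) (labels-map (⊝ ==_) a X))

  -- Known normal coins

  -- An order embedding of the coins of a pile that may still be counterfeit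
  -- into Fin N; the remaining coins of the pile are known to be normal.
  data Embed : ℕ → ℕ → Set where
    []        : Embed 0 N
    candidate : Embed n N → Embed (suc n) (suc N)
    normal    : Embed n N → Embed (suc n) N

  -- A relation rather than a function, since a normal coin has no image. The places left over by
  -- `[] : Embed 0 N` allow fewer than `N` candidates.
  data _⊢_↦_ : Embed n N → Fin n → Fin N → Set where
    zero      : {e : Embed n N} → candidate e ⊢ zero ↦ zero
    candidate : {e : Embed n N} {x : Fin n} {y : Fin N} → e ⊢ x ↦ y → candidate e ⊢ suc x ↦ suc y
    normal    : {e : Embed n N} {x : Fin n} {y : Fin N} → e ⊢ x ↦ y → normal e ⊢ suc x ↦ y

  ↦-injective : {e : Embed n N} {x x′ : Fin n} {y : Fin N} → e ⊢ x ↦ y → e ⊢ x′ ↦ y → x ≡ x′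
  ↦-injective zero          zero          = refl
  ↦-injective (candidate p) (candidate q) = cong suc (↦-injective p q)
  ↦-injective (normal p)    (normal q)    = cong suc (↦-injective p q)

  candidates normals : Embed n N → ℕ
  candidates []            = 0
  candidates (candidate e) = suc (candidates e)
  candidates (normal e)    = candidates e
  normals []            = 0
  normals (candidate e) = normals e
  normals (normal e)    = suc (normals e)

  -- The preimage of a set of coins, together with d of the normal coins.
  preimage : Embed n N → Subset N → ℕ → Subset n
  preimage []            _       _       = []
  preimage (candidate e) (b ∷ S) d       = b ∷ preimage e S d
  preimage (normal e)    S       zero    = outside ∷ preimage e S zero
  preimage (normal e)    S       (suc d) = inside ∷ preimage e S d

  ∣preimage∣ : (e : Embed n N) (S : Subset N) (d : ℕ) → d ≤ normals e →
               ∣ preimage e S d ∣ₛ ≡ ∣ preimage e S 0 ∣ₛ + d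
  ∣preimage∣ []            S           zero    z≤n     = refl
  ∣preimage∣ (candidate e) (true  ∷ S) d       d≤      = cong suc (∣preimage∣ e S d d≤)
  ∣preimage∣ (candidate e) (false ∷ S) d       d≤      = ∣preimage∣ e S d d≤
  ∣preimage∣ (normal e)    S           zero    d≤      = sym (+-identityʳ _)
  ∣preimage∣ (normal e)    S           (suc d) (s≤s d≤) =
    trans (cong suc (∣preimage∣ e S d d≤)) (sym (+-suc _ d))

  ∣preimage∣≤candidates : (e : Embed n N) (S : Subset N) → ∣ preimage e S 0 ∣ₛ ≤ candidates e
  ∣preimage∣≤candidates []            S           = z≤n
  ∣preimage∣≤candidates (candidate e) (true  ∷ S) = s≤s (∣preimage∣≤candidates e S)
  ∣preimage∣≤candidates (candidate e) (false ∷ S) = m≤n⇒m≤1+n (∣preimage∣≤candidates e S)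
  ∣preimage∣≤candidates (normal e)    S           = ∣preimage∣≤candidates e S

  lookup-preimage : {e : Embed n N} {x : Fin n} {y : Fin N} (S : Subset N) (d : ℕ) → e ⊢ x ↦ y →
                    lookup (preimage e S d) x ≡ lookup S y
  lookup-preimage (b ∷ S) d       zero          = refl
  lookup-preimage (b ∷ S) d       (candidate p) = lookup-preimage S d p
  lookup-preimage S       zero    (normal p)    = lookup-preimage S zero p
  lookup-preimage S       (suc d) (normal p)    = lookup-preimage S d p

  Embeds : Vec ℕ m → Vec ℕ m → Set
  Embeds = Pointwise Embed

  data _⊩_↦_ : Embeds ns Ns → Configuration ns → Configuration Ns → Set where
    []  : [] ⊩ [] ↦ []
    _∷_ : {e : Embed n N} {E : Embeds ns Ns} {x : Fin n} {y : Fin N}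
          {X : Configuration ns} {Y : Configuration Ns} →
          e ⊢ x ↦ y → E ⊩ X ↦ Y → (e ∷ E) ⊩ x ∷ X ↦ (y ∷ Y)

  ⊩-injective : {E : Embeds ns Ns} {X X′ : Configuration ns} {Y : Configuration Ns} →
                E ⊩ X ↦ Y → E ⊩ X′ ↦ Y → X ≡ X′
  ⊩-injective []      []      = refl
  ⊩-injective (p ∷ P) (q ∷ Q) = cong₂ _∷_ (↦-injective p q) (⊩-injective P Q)

  total : (∀ {n N} → Embed n N → ℕ) → Embeds ns Ns → ℕ
  total f []      = 0
  total f (e ∷ E) = f e + total f E

  -- The `d` normal coins are taken greedily, as many as possible from the first pile and the rest
  -- from the others. Hence only the total supply over all piles counts.
  preimages : Embeds ns Ns → CoinSet Ns → ℕ → CoinSet ns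
  preimages []      []       d = []
  preimages (e ∷ E) (S ∷ Ss) d = preimage e S (d ⊓ normals e) ∷ preimages E Ss (d ∸ normals e)

  ∣preimages∣₀ : Embeds ns Ns → CoinSet Ns → ℕ
  ∣preimages∣₀ []      []       = 0
  ∣preimages∣₀ (e ∷ E) (S ∷ Ss) = ∣ preimage e S 0 ∣ₛ + ∣preimages∣₀ E Ss

  +-interchange : ∀ a b c d → (a + b) + (c + d) ≡ (a + c) + (b + d)
  +-interchange a b c d = begin
    (a + b) + (c + d) ≡⟨ +-assoc a b (c + d) ⟩
    a + (b + (c + d)) ≡⟨ cong (a +_) (+-assoc b c d) ⟨
    a + ((b + c) + d) ≡⟨ cong (λ x → a + (x + d)) (+-comm b c) ⟩
    a + ((c + b) + d) ≡⟨ cong (a +_) (+-assoc c b d) ⟩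
    a + (c + (b + d)) ≡⟨ +-assoc a c (b + d) ⟨
    (a + c) + (b + d) ∎
    where open ≡-Reasoning

  ∣preimages∣ : (E : Embeds ns Ns) (S : CoinSet Ns) (d : ℕ) → d ≤ total normals E →
                ∣ preimages E S d ∣ ≡ ∣preimages∣₀ E S + d
  ∣preimages∣ []      []       zero z≤n = refl
  ∣preimages∣ (e ∷ E) (S ∷ Ss) d    d≤  = begin
    ∣ preimage e S (d ⊓ c) ∣ₛ + ∣ preimages E Ss (d ∸ c) ∣
      ≡⟨ cong₂ _+_ (∣preimage∣ e S (d ⊓ c) (m⊓n≤n d c))
                   (∣preimages∣ E Ss (d ∸ c) (m≤n+o⇒m∸n≤o d c d≤)) ⟩
    (a + d ⊓ c) + (b + (d ∸ c))
      ≡⟨ +-interchange a (d ⊓ c) b (d ∸ c) ⟩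
    (a + b) + (d ⊓ c + (d ∸ c))
      ≡⟨ cong (a + b +_) (trans (cong (_+ (d ∸ c)) (⊓-comm d c)) (m⊓n+n∸m≡n c d)) ⟩
    (a + b) + d ∎
    where
    open ≡-Reasoning
    c = normals e
    a = ∣ preimage e S 0 ∣ₛ
    b = ∣preimages∣₀ E Ss

  ∣preimages∣≤candidates : (E : Embeds ns Ns) (S : CoinSet Ns) → ∣preimages∣₀ E S ≤ total candidates E
  ∣preimages∣≤candidates []      []       = z≤n
  ∣preimages∣≤candidates (e ∷ E) (S ∷ Ss) =
    +-mono-≤ (∣preimage∣≤candidates e S) (∣preimages∣≤candidates E Ss)

  labels-preimages : {E : Embeds ns Ns} {X : Configuration ns} {Y : Configuration Ns}
                     (S : CoinSet Ns) (d : ℕ) → E ⊩ X ↦ Y →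
                     labels (preimages E S d) X ≡ labels S Y
  labels-preimages []       d []                = refl
  labels-preimages (S ∷ Ss) d (_∷_ {e = e} p P) =
    cong₂ _∷_ (lookup-preimage S (d ⊓ normals e) p) (labels-preimages Ss (d ∸ normals e) P)

  -- Both sides are the maximum of `m` and `n`: after filling up, each pan has the size of the
  -- larger one.
  m+[n∸m]≡n+[m∸n] : ∀ m n → m + (n ∸ m) ≡ n + (m ∸ n)
  m+[n∸m]≡n+[m∸n] m n with ≤-total m n
  ... | inj₁ m≤n rewrite m≤n⇒m∸n≡0 m≤n = trans (m+[n∸m]≡n m≤n) (sym (+-identityʳ n))
  ... | inj₂ n≤m rewrite m≤n⇒m∸n≡0 n≤m = trans (+-identityʳ m) (sym (m+[n∸m]≡n n≤m))

  -- The preimages of the two pans need not have the same size, but enough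
  -- normal coins are available to fill up the smaller one.
  module _ {ns Ns : Vec ℕ m} (E : Embeds ns Ns) (supply : total candidates E ≤ total normals E) where

    simulate : Weighing Ns → Weighing ns
    simulate w = weighing (preimages E L (r ∸ l)) (preimages E R (l ∸ r)) (begin
      ∣ preimages E L (r ∸ l) ∣ ≡⟨ ∣preimages∣ E L (r ∸ l) (fits R l) ⟩
      l + (r ∸ l)               ≡⟨ m+[n∸m]≡n+[m∸n] l r ⟩
      r + (l ∸ r)               ≡⟨ ∣preimages∣ E R (l ∸ r) (fits L r) ⟨
      ∣ preimages E R (l ∸ r) ∣ ∎)
      where
      open ≡-Reasoning
      L = left w
      R = right w
      l = ∣preimages∣₀ E L
      r = ∣preimages∣₀ E R
      fits : ∀ S k → ∣preimages∣₀ E S ∸ k ≤ total normals E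
      fits S k = ≤-trans (m∸n≤m (∣preimages∣₀ E S) k) (≤-trans (∣preimages∣≤candidates E S) supply)

    outcome-simulate : (w : Weighing Ns) {X : Configuration ns} {Y : Configuration Ns} →
                       E ⊩ X ↦ Y → outcome (simulate w) X ≡ outcome w Y
    outcome-simulate w {X} {Y} P = begin
      outcome (simulate w) X ≡⟨ outcome-labels (simulate w) X ⟩
      sgn (∣ labels (left (simulate w)) X ∣ₛ ⊖ ∣ labels (right (simulate w)) X ∣ₛ)
        ≡⟨ cong₂ (λ S T → sgn (∣ S ∣ₛ ⊖ ∣ T ∣ₛ))
                 (labels-preimages (left w) _ P) (labels-preimages (right w) _ P) ⟩
      sgn (∣ labels (left w) Y ∣ₛ ⊖ ∣ labels (right w) Y ∣ₛ) ≡⟨ outcome-labels w Y ⟨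
      outcome w Y ∎
      where open ≡-Reasoning

    simulateAll : Algorithm Ns t → Algorithm ns t
    simulateAll stop        = stop
    simulateAll (weigh w A) = weigh (simulate w) λ o → simulateAll (A o)

    outcomes-simulate : (A : Algorithm Ns t) {X : Configuration ns} {Y : Configuration Ns} →
                        E ⊩ X ↦ Y → outcomes (simulateAll A) X ≡ outcomes A Y
    outcomes-simulate stop        P = refl
    outcomes-simulate (weigh w A) P rewrite outcome-simulate w P =
      cong (_ ∷_) (outcomes-simulate (A _) P)

    -- The simulation reproduces the outcomes of `A` on the images, so equal outcomes force equal
    -- images, and the embedding is injective on candidates.
    solvable-embedded : Solvable Ns t → SolvableOn (λ X → ∃[ Y ] E ⊩ X ↦ Y) t
    solvable-embedded (A , h) = simulateAll A , λ X X′ (Y , P) (Y′ , P′) eq →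
      ⊩-injective P (subst (E ⊩ X′ ↦_)
        (h Y′ Y (trans (sym (outcomes-simulate A P′)) (trans (sym eq) (outcomes-simulate A P)))) P′)

  -- Weighing thirds of the piles

  select : ∀ o (v : Vec Outcome n) → #[ o ] v ≤ N → Embed n N
  select o []      _ = []
  select o (s ∷ v) p with o == s
  select {N = suc N} o (s ∷ v) (s≤s p) | true  = candidate (select o v p)
  select             o (s ∷ v) p       | false = normal (select o v p)

  ==-refl : ∀ o → (o == o) ≡ true
  ==-refl ⊕ = refl
  ==-refl ⊙ = refl
  ==-refl ⊝ = refl

  select-covers : ∀ o (v : Vec Outcome n) (p : #[ o ] v ≤ N) x → lookup v x ≡ o →
                  ∃[ y ] select o v p ⊢ x ↦ y
  select-covers o (s ∷ v) p zero refl with o == o | ==-refl o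
  select-covers {N = suc N} o (s ∷ v) (s≤s p) zero refl | true | _ = zero , zero
  select-covers o (s ∷ v) p (suc x) e with o == s
  select-covers {N = suc N} o (s ∷ v) (s≤s p) (suc x) e | true =
    let y , q = select-covers o v p x e in suc y , candidate q
  select-covers o (s ∷ v) p (suc x) e | false =
    let y , q = select-covers o v p x e in y , normal q

  candidates-select : ∀ o (v : Vec Outcome n) (p : #[ o ] v ≤ N) → candidates (select o v p) ≡ #[ o ] v
  candidates-select o []      p = refl
  candidates-select o (s ∷ v) p with o == s
  candidates-select {N = suc N} o (s ∷ v) (s≤s p) | true  = cong suc (candidates-select o v p)
  candidates-select             o (s ∷ v) p       | false = candidates-select o v p

  candidates+normals : (e : Embed n N) → candidates e + normals e ≡ n
  candidates+normals []            = refl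
  candidates+normals (candidate e) = cong suc (candidates+normals e)
  candidates+normals (normal e)    =
    trans (+-suc (candidates e) (normals e)) (cong suc (candidates+normals e))

  -- The outcome of weighing a pile alone is the side of its counterfeit. So every side must fit
  -- into `N` places (`small`) and contain at most half of the pile (`halved`), which leaves at
  -- least as many normal coins as candidates.
  record Thirds (n N : ℕ) : Set where
    field
      sides  : Vec Outcome n
      even   : #[ ⊕ ] sides ≡ #[ ⊝ ] sides
      small  : ∀ o → #[ o ] sides ≤ N
      halved : ∀ o → #[ o ] sides + #[ o ] sides ≤ n

    embed : Outcome → Embed n N
    embed o = select o sides (small o)

    supply : ∀ o → candidates (embed o) ≤ normals (embed o)
    supply o = +-cancelˡ-≤ (candidates e) _ _ (begin
      candidates e + candidates e ≡⟨ cong (λ k → k + k) (candidates-select o sides (small o)) ⟩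
      #[ o ] sides + #[ o ] sides ≤⟨ halved o ⟩
      n                           ≡⟨ candidates+normals e ⟨
      candidates e + normals e    ∎)
      where
      open ≤-Reasoning
      e = embed o

  #-block : ∀ o s k (v : Vec Outcome n) → (o == s) ≡ true → #[ o ] (replicate k s Vec.++ v) ≡ k + #[ o ] v
  #-block o s zero    v e = refl
  #-block o s (suc k) v e rewrite e = cong suc (#-block o s k v e)

  #-block₀ : ∀ o s k (v : Vec Outcome n) → (o == s) ≡ false → #[ o ] (replicate k s Vec.++ v) ≡ #[ o ] v
  #-block₀ o s zero    v e = refl
  #-block₀ o s (suc k) v e rewrite e = #-block₀ o s k v e

  -- The length is that of three concatenated blocks, with `x` coins on each pan and `y` aside. The
  -- condition `y ≤ x + x` says that the coins aside are at most half of the pile.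
  thirds : ∀ x y → x ≤ N → y ≤ N → y ≤ x + x → Thirds (x + (y + (x + 0))) N
  thirds {N} x y x≤N y≤N y≤2x = record
    { sides  = v
    ; even   = trans #⊕ (sym #⊝)
    ; small  = λ { ⊕ → subst (_≤ N) (sym #⊕) x≤N
                 ; ⊙ → subst (_≤ N) (sym #⊙) y≤N
                 ; ⊝ → subst (_≤ N) (sym #⊝) x≤N }
    ; halved = λ { ⊕ → subst (λ k → k + k ≤ l) (sym #⊕) 2x≤n
                 ; ⊙ → subst (λ k → k + k ≤ l) (sym #⊙) 2y≤n
                 ; ⊝ → subst (λ k → k + k ≤ l) (sym #⊝) 2x≤n }
    }
    where
    l = x + (y + (x + 0))
    v₂ : Vec Outcome (x + 0)
    v₂ = replicate x ⊝ Vec.++ []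
    v₁ : Vec Outcome (y + (x + 0))
    v₁ = replicate y ⊙ Vec.++ v₂
    v : Vec Outcome l
    v = replicate x ⊕ Vec.++ v₁
    #⊕ : #[ ⊕ ] v ≡ x
    #⊕ = trans (#-block ⊕ ⊕ x v₁ refl) (trans (cong (x +_)
      (trans (#-block₀ ⊕ ⊙ y v₂ refl) (#-block₀ ⊕ ⊝ x [] refl))) (+-identityʳ x))
    #⊙ : #[ ⊙ ] v ≡ y
    #⊙ = trans (#-block₀ ⊙ ⊕ x v₁ refl) (trans (#-block ⊙ ⊙ y v₂ refl)
      (trans (cong (y +_) (#-block₀ ⊙ ⊝ x [] refl)) (+-identityʳ y)))
    #⊝ : #[ ⊝ ] v ≡ x
    #⊝ = trans (#-block₀ ⊝ ⊕ x v₁ refl) (trans (#-block₀ ⊝ ⊙ y v₂ refl)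
      (trans (#-block ⊝ ⊝ x [] refl) (+-identityʳ x)))
    open ≤-Reasoning
    2x≤n : x + x ≤ l
    2x≤n = +-monoʳ-≤ x (≤-trans (m≤m+n x 0) (m≤n+m (x + 0) y))
    2y≤n : y + y ≤ l
    2y≤n = begin
      y + y             ≤⟨ +-monoʳ-≤ y y≤2x ⟩
      y + (x + x)       ≡⟨ cong (λ k → y + (x + k)) (+-identityʳ x) ⟨
      y + (x + (x + 0)) ≡⟨ +-assoc y x (x + 0) ⟨
      (y + x) + (x + 0) ≡⟨ cong (_+ (x + 0)) (+-comm y x) ⟩
      (x + y) + (x + 0) ≡⟨ +-assoc x y (x + 0) ⟩
      x + (y + (x + 0)) ∎

  -- A pile of one coin has no such split, as `x = 0` and `y = 1` violate `y ≤ x + x`. Piles of 2, 3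
  -- and 4 coins are split by hand, the last one as 1, 2, 1 with equality in that condition; three
  -- more coins enlarge each block by one.
  split₃ : ∀ n N → 2 + n ≤ 3 * N →
           ∃[ x ] ∃[ y ] x + (y + (x + 0)) ≡ 2 + n × x ≤ N × y ≤ N × y ≤ x + x
  split₃ 0 (suc N) _ = 1 , 0 , refl , s≤s z≤n , z≤n , z≤n
  split₃ 1 (suc N) _ = 1 , 1 , refl , s≤s z≤n , s≤s z≤n , s≤s z≤n
  split₃ 2 (suc (suc N)) _ = 1 , 2 , refl , s≤s z≤n , s≤s (s≤s z≤n) , ≤-refl
  split₃ 2 (suc zero) (s≤s (s≤s (s≤s ())))
  split₃ (suc (suc (suc n))) (suc N) h
    with split₃ n N (+-cancelˡ-≤ 3 _ _ (subst (5 + n ≤_) (*-suc 3 N) h))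
  ... | x , y , e , x≤N , y≤N , y≤2x =
    suc x , suc y , cong suc (trans (+-suc x _) (cong suc (trans (+-suc′ x y) (cong suc e)))) ,
    s≤s x≤N , s≤s y≤N , s≤s (≤-trans y≤2x (+-monoʳ-≤ x (n≤1+n x)))
    where
    +-suc′ : ∀ x y → x + (y + suc (x + 0)) ≡ suc (x + (y + (x + 0)))
    +-suc′ x y = trans (cong (x +_) (+-suc y (x + 0))) (+-suc x (y + (x + 0)))

  thirds-of : ∀ n N → 2 ≤ n → n ≤ 3 * N → Thirds n N
  thirds-of (suc zero)    N (s≤s ()) _
  thirds-of (suc (suc n)) N _ h with split₃ n N h
  ... | x , y , e , x≤N , y≤N , y≤2x = subst (λ k → Thirds k N) e (thirds x y x≤N y≤N y≤2x)

  aside : (ns : Vec ℕ m) → Placement ns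
  aside []       = []
  aside (n ∷ ns) = replicate n ⊙ ∷ aside ns

  #-aside : ∀ o n → (o == ⊙) ≡ false → #[ o ] (replicate n ⊙) ≡ 0
  #-aside o zero    e = refl
  #-aside o (suc n) e rewrite e = #-aside o n e

  ∣pan-aside∣ : ∀ o (ns : Vec ℕ m) → (o == ⊙) ≡ false → ∣ pan o (aside ns) ∣ ≡ 0
  ∣pan-aside∣ o []       e = refl
  ∣pan-aside∣ o (n ∷ ns) e = cong₂ _+_ (#-aside o n e) (∣pan-aside∣ o ns e)

  labels-aside : (X : Configuration ns) → ∀ o → (o == ⊙) ≡ false → #[ o ] (labels (aside ns) X) ≡ 0
  labels-aside [] o e = refl
  labels-aside {ns = n ∷ ns} (x ∷ X) o e rewrite Vec.lookup-replicate x ⊙ | e = labels-aside X o e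

  balanced-alone : (ns : Vec ℕ m) (v : Vec Outcome n) → #[ ⊕ ] v ≡ #[ ⊝ ] v →
                   ∣ pan ⊕ (v ∷ aside ns) ∣ ≡ ∣ pan ⊝ (v ∷ aside ns) ∣
  balanced-alone ns v even = cong₂ _+_ even (trans (∣pan-aside∣ ⊕ ns refl) (sym (∣pan-aside∣ ⊝ ns refl)))

  weighPile : (ns : Vec ℕ m) (v : Vec Outcome n) → #[ ⊕ ] v ≡ #[ ⊝ ] v → Weighing (n ∷ ns)
  weighPile ns v even = place (v ∷ aside ns) (balanced-alone ns v even)

  tally-alone : ∀ s (os : Vec Outcome m) → #[ ⊕ ] os ≡ 0 → #[ ⊝ ] os ≡ 0 → tally (s ∷ os) ≡ s
  tally-alone ⊕ os p q rewrite p | q = refl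
  tally-alone ⊙ os p q rewrite p | q = refl
  tally-alone ⊝ os p q rewrite p = refl

  outcome-weighPile : (v : Vec Outcome n) (even : #[ ⊕ ] v ≡ #[ ⊝ ] v)
                      (x : Fin n) (X : Configuration ns) →
                      outcome (weighPile ns v even) (x ∷ X) ≡ lookup v x
  outcome-weighPile {ns = ns} v even x X =
    trans (outcome-place (v ∷ aside ns) (balanced-alone ns v even) (x ∷ X))
    (tally-alone (lookup v x) (labels (aside ns) X) (labels-aside X ⊕ refl) (labels-aside X ⊝ refl))

  addPile : ∀ n → Weighing ns → Weighing (n ∷ ns)
  addPile n (weighing L R e) =
    weighing (replicate n outside ∷ L) (replicate n outside ∷ R) (cong (∣ replicate n outside ∣ₛ +_) e)

  outcome-addPile : (w : Weighing ns) (x : Fin n) (X : Configuration ns) →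
                    outcome (addPile n w) (x ∷ X) ≡ outcome w X
  outcome-addPile {n = n} w@(weighing L R e) x X =
    trans (outcome-labels (addPile n w) (x ∷ X)) (trans lemma (sym (outcome-labels w X)))
    where
    b = lookup (replicate n outside) x
    lemma : sgn (∣ b ∷ labels L X ∣ₛ ⊖ ∣ b ∷ labels R X ∣ₛ)
            ≡ sgn (∣ labels L X ∣ₛ ⊖ ∣ labels R X ∣ₛ)
    lemma rewrite Vec.lookup-replicate x outside = refl

  weighThirds : {ns Ns : Vec ℕ m} → Pointwise Thirds ns Ns → Vec (Weighing ns) m
  weighThirds []       = []
  weighThirds (h ∷ hs) =
    weighPile _ (Thirds.sides h) (Thirds.even h) ∷ Vec.map (addPile _) (weighThirds hs)

  outcomes-addPile : (ws : Vec (Weighing ns) m) (x : Fin n) (X : Configuration ns) →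
                     Vec.map (λ w → outcome w (x ∷ X)) (Vec.map (addPile n) ws) ≡
                     Vec.map (λ w → outcome w X) ws
  outcomes-addPile []       x X = refl
  outcomes-addPile (w ∷ ws) x X = cong₂ _∷_ (outcome-addPile w x X) (outcomes-addPile ws x X)

  embeds : {ns Ns : Vec ℕ m} → Pointwise Thirds ns Ns → Vec Outcome m → Embeds ns Ns
  embeds []       []       = []
  embeds (h ∷ hs) (o ∷ os) = Thirds.embed h o ∷ embeds hs os

  embeds-supply : {ns Ns : Vec ℕ m} (hs : Pointwise Thirds ns Ns) (os : Vec Outcome m) →
                  total candidates (embeds hs os) ≤ total normals (embeds hs os)
  embeds-supply []       []       = z≤n
  embeds-supply (h ∷ hs) (o ∷ os) = +-mono-≤ (Thirds.supply h o) (embeds-supply hs os)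

  -- Weighings of the other piles leave a pile aside, so its own weighing reveals the side of its
  -- counterfeit, and `select` keeps exactly the coins of that side.
  embeds-cover : {ns Ns : Vec ℕ m} (hs : Pointwise Thirds ns Ns) (X : Configuration ns)
                 (os : Vec Outcome m) →
                 Vec.map (λ w → outcome w X) (weighThirds hs) ≡ os → ∃[ Y ] embeds hs os ⊩ X ↦ Y
  embeds-cover []       []      []       _ = [] , []
  embeds-cover (h ∷ hs) (x ∷ X) (o ∷ os) e with Vec.∷-injective e
  ... | e₁ , e₂ =
    let y , p = select-covers o (Thirds.sides h) (Thirds.small h o) x
                  (trans (sym (outcome-weighPile (Thirds.sides h) (Thirds.even h) x X)) e₁)
        Y , P = embeds-cover hs X os (trans (sym (outcomes-addPile (weighThirds hs) x X)) e₂)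
    in y ∷ Y , p ∷ P

  solvable-thirds : {ns Ns : Vec ℕ m} → Pointwise Thirds ns Ns → Solvable Ns t → Solvable ns (m + t)
  solvable-thirds {m} {t} {ns} hs s = let A , h = on in A , λ X Y → h X Y _ _
    where
    on : SolvableOn (λ _ → ⊤) (m + t)
    on = weigh-all (weighThirds hs) λ os →
      solvableOn-⊆ (λ X (_ , e) → embeds-cover hs X os e)
                   (solvable-embedded (embeds hs os) (embeds-supply hs os) s)

  replicate⁺ : {R : ℕ → ℕ → Set} → ∀ m → R n N → Pointwise R (replicate m n) (replicate m N)
  replicate⁺ zero    r = []
  replicate⁺ (suc m) r = r ∷ replicate⁺ m r

  solvable-unique : ∀ m → n ≤ 1 → Solvable (replicate m n) t
  solvable-unique {n} m n≤1 = stop , λ X Y _ → unique m X Y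
    where
    fin : n ≤ 1 → (x y : Fin n) → x ≡ y
    fin (s≤s z≤n) zero zero = refl
    unique : ∀ m (X Y : Configuration (replicate m n)) → X ≡ Y
    unique zero    []      []      = refl
    unique (suc m) (x ∷ X) (y ∷ Y) = cong₂ _∷_ (fin n≤1 x y) (unique m X Y)

  solvable-triple : ∀ n N → n ≤ 3 * N → Solvable (replicate m N) t → Solvable (replicate m n) (m + t)
  -- Piles of at most one coin cannot be split into thirds, but they admit at most one
  -- configuration.
  solvable-triple {m} 0             N _ s = solvable-unique m z≤n
  solvable-triple {m} 1             N _ s = solvable-unique m (s≤s z≤n)
  solvable-triple {m} (suc (suc n)) N h s =
    solvable-thirds (replicate⁺ m (thirds-of (suc (suc n)) N (s≤s (s≤s z≤n)) h)) s

  -- Strategies up to relabelling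

  -- Coins of a pile that play the same role get the same label. A state lists the
  -- labels of the coins of each pile and the label vectors of the configurations
  -- that are still possible; normal coins carry a label occurring in none of these.
  State : ℕ → Set
  State m = Vec (List ℕ) m × List (Vec ℕ m)

  Realizes : {ns : Vec ℕ m} → All (Vec A) ns → Vec (List A) m → Set
  Realizes []       []       = ⊤
  Realizes (v ∷ vs) (p ∷ ps) = Vec.toList v ↭ p × Realizes vs ps

  -- Quantifying over all labellings that realize the state makes it independent of the branch in
  -- which it arises, so that one strategy serves every occurrence.
  SolvableState : State m → ℕ → Set
  SolvableState {m} (ps , ts) t = {ns : Vec ℕ m} (vs : All (Vec ℕ) ns) → Realizes vs ps →
                                  SolvableOn (λ X → labels vs X ∈ ts) t

  -- The label of a coin and its pan.
  Kind : Set
  Kind = ℕ × Outcome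

  _≟ᵒ_ : DecidableEquality Outcome
  ⊕ ≟ᵒ ⊕ = yes refl
  ⊕ ≟ᵒ ⊙ = no λ ()
  ⊕ ≟ᵒ ⊝ = no λ ()
  ⊙ ≟ᵒ ⊕ = no λ ()
  ⊙ ≟ᵒ ⊙ = yes refl
  ⊙ ≟ᵒ ⊝ = no λ ()
  ⊝ ≟ᵒ ⊕ = no λ ()
  ⊝ ≟ᵒ ⊙ = no λ ()
  ⊝ ≟ᵒ ⊝ = yes refl

  _≟ᵏ_ : DecidableEquality Kind
  (a , o) ≟ᵏ (b , p) =
    map′ (λ { (refl , refl) → refl }) (λ { refl → refl , refl }) (a ≟ b ×-dec o ≟ᵒ p)

  -- Comparing the fingerprints first only serves to speed up the comparison.
  fingerprint : State m → ℕ
  fingerprint (ps , ts) = Vec.foldr _ hash (foldr (λ t → hash (Vec.toList t)) 0 ts) ps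
    where
    hash : List ℕ → ℕ → ℕ
    hash xs h = List.foldl (λ h x → (h * 1000003 + x) % 2305843009213693951) h xs

  mark : State m → ℕ × State m
  mark s = fingerprint s , s

  -- The fingerprint is a polynomial hash modulo the Mersenne prime `2 ^ 61 - 1`. States with equal
  -- fingerprints are still compared in full, so a collision only costs time.
  _≟ˢ_ : DecidableEquality (ℕ × State m)
  (h , ps , ts) ≟ˢ (h′ , ps′ , ts′) =
    map′ (λ { (refl , refl , refl) → refl }) (λ { refl → refl , refl , refl })
         (h ≟ h′ ×-dec Vec.≡-dec (List.≡-dec _≟_) ps ps′ ×-dec List.≡-dec (Vec.≡-dec _≟_) ts ts′)

  -- Successor states of a weighing

  Tagged : ℕ → Set
  Tagged m = Vec (List Kind) m × List (Vec ℕ m)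

  tag : List ℕ → List Outcome → List Kind
  tag []       _        = []
  -- Coins beyond the end of the word stay aside, so trailing zeros can be omitted and every word
  -- describes some placement.
  tag (a ∷ as) []       = (a , ⊙) ∷ tag as []
  tag (a ∷ as) (o ∷ os) = (a , o) ∷ tag as os

  weight : Outcome → Vec (List Kind) m → ℕ
  weight o []       = 0
  weight o (z ∷ zs) = Σ (List.map (λ k → if o == proj₂ k then 1 else 0) z) + weight o zs

  choices : Vec (List A) m → List (Vec A m)
  choices []         = [] ∷ []
  choices (xs ∷ xss) = cartesianProductWith _∷_ xs (choices xss)

  -- Coins with one label may be spread over both pans and the table, so a label vector splits into
  -- one vector of kinds for each combination of places that its labels occupy.
  refinements : Vec (List Kind) m → Vec ℕ m → List (Vec Kind m)
  refinements ks t = choices (Vec.zipWith (λ k a → filter (λ κ → proj₁ κ ≟ a) k) ks t)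

  refined : Vec (List Kind) m → List (Vec ℕ m) → List (Vec Kind m)
  refined zs = concatMap (refinements (Vec.map (deduplicate _≟ᵏ_) zs))

  result : Vec Kind m → Outcome
  result r = tally (Vec.map proj₂ r)

  after : Outcome → List (Vec Kind m) → List (Vec Kind m)
  after o = filter (λ r → result r ≟ᵒ o)

  infix 4 _<ˡ_
  _<ˡ_ : Vec ℕ m → Vec ℕ m → Bool
  []      <ˡ []      = false
  (x ∷ v) <ˡ (y ∷ w) = if x ≡ᵇ y then v <ˡ w else x <ᵇ y

  -- Sorting lexicographically and removing duplicates makes equal sets of label vectors equal
  -- lists. Soundness rests only on no vector getting lost.
  insert : Vec ℕ m → List (Vec ℕ m) → List (Vec ℕ m)
  insert v []       = v ∷ []
  insert v (w ∷ ws) with Vec.≡-dec _≟_ v w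
  ... | yes _ = w ∷ ws
  ... | no  _ = if v <ˡ w then v ∷ w ∷ ws else w ∷ insert v ws

  -- The entry at `i` is overwritten by a dummy, so that slices of different kinds can be compared.
  -- If they agree, exchanging the two kinds in pile `i` preserves the set of remaining vectors.
  slice : List (Vec Kind m) → Fin m → Kind → List (Vec Kind m)
  slice rs i κ = List.map (Vec._[ i ]≔ (0 , ⊙)) (filter (λ r → lookup r i ≟ᵏ κ) rs)

  -- A group consists of kinds with a common slice, and counts their coins.
  Group : ℕ → Set
  Group m = List (Vec Kind m) × ℕ × List Kind

  -- An empty slice means that no remaining vector has this kind in this pile, so its coins are
  -- normal. They enter no group, and `position` sends all of them to the number of groups, a label
  -- that no remaining vector uses.
  join : List (Vec Kind m) → ℕ → Kind → List (Group m) → List (Group m)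
  join []        c κ gs = gs
  join s@(_ ∷ _) c κ [] = (s , c , κ ∷ []) ∷ []
  join s@(_ ∷ _) c κ ((s′ , c′ , κs) ∷ gs) with List.≡-dec (Vec.≡-dec _≟ᵏ_) s s′
  ... | yes _ = (s′ , c′ + c , κs List.∷ʳ κ) ∷ gs
  ... | no  _ = (s′ , c′ , κs) ∷ join s c κ gs

  insertGroup : Group m → List (Group m) → List (Group m)
  insertGroup g []       = g ∷ []
  insertGroup g (h ∷ gs) =
    if proj₁ (proj₂ g) <ᵇ proj₁ (proj₂ h) then h ∷ insertGroup g gs else g ∷ h ∷ gs

  groups : List (Vec Kind m) → Fin m → List Kind → List (List Kind)
  groups rs i z = List.map (proj₂ ∘ proj₂) (foldr insertGroup []
    (List.foldl (λ gs κ → join (slice rs i κ) (length (filter (κ ≟ᵏ_) z)) κ gs) [] (deduplicate _≟ᵏ_ z)))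

  position : List (List Kind) → Kind → ℕ
  position []         κ = 0
  position (κs ∷ κss) κ = if does (any? (κ ≟ᵏ_) κs) then 0 else suc (position κss κ)

  -- Any relabelling would be sound. This one merges kinds that have become
  -- interchangeable and orders the labels by their numbers of coins, which makes
  -- the same states occur again and again.
  newLabels : List (Vec Kind m) → Vec (List Kind) m → Vec (Kind → ℕ) m
  newLabels rs zs = Vec.tabulate λ i → position (groups rs i (lookup zs i))

  rename : Vec (Kind → ℕ) m → Vec Kind m → Vec ℕ m
  rename fs r = Vec.zipWith (λ f κ → f κ) fs r

  relabelled : Vec (List Kind) m → List (Vec Kind m) → Vec (Kind → ℕ) m → State m
  relabelled zs rs fs =
    Vec.zipWith (λ f z → sort (List.map f z)) fs zs , foldr insert [] (List.map (rename fs) rs)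

  successor : Vec (List Kind) m → List (Vec Kind m) → Outcome → State m
  successor zs rs o = relabelled zs (after o rs) (newLabels (after o rs) zs)

  successors : Tagged m → List (State m)
  successors (zs , ts) = List.map (successor zs (refined zs ts)) (⊕ ∷ ⊙ ∷ ⊝ ∷ [])

  -- Checking a certificate level by level

  uniqueᵇ : Vec (List ℕ) m → Vec ℕ m → Bool
  uniqueᵇ []       []      = true
  uniqueᵇ (p ∷ ps) (a ∷ t) = (length (filter (_≟ a) p) ≤ᵇ 1) ∧ uniqueᵇ ps t

  -- A label stands for a class of coins, so a single remaining vector determines the configuration
  -- only if each of its labels belongs to one coin; the initial `box` shows the difference.
  solved : State m → Bool
  solved (ps , [])        = true
  solved (ps , t ∷ [])    = uniqueᵇ ps t
  solved (ps , _ ∷ _ ∷ _) = false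

  -- Piles are kept sorted, so run lengths are the numbers of coins per label, in the order in which
  -- a word addresses the labels.
  runs : List ℕ → List ℕ
  runs []       = []
  runs (a ∷ as) = go 1 a as
    where
    go : ℕ → ℕ → List ℕ → List ℕ
    go k a []       = k ∷ []
    go k a (b ∷ bs) = if a ≡ᵇ b then go (suc k) a bs else k ∷ go 1 b bs

  word : List ℕ → List ℕ → List Outcome
  word (s ∷ ss) (l ∷ r ∷ ds) =
    List.replicate l ⊕ List.++ List.replicate (s ∸ l ∸ r) ⊙ List.++ List.replicate r ⊝ List.++
    word ss ds
  word _ _ = []

  Instruction : Set
  Instruction = List (List ℕ)

  tagged : Vec (List ℕ) m → Instruction → Vec (List Kind) m
  tagged []       _        = []
  tagged (p ∷ ps) []       = tag p [] ∷ tagged ps []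
  tagged (p ∷ ps) (i ∷ is) = tag p (word (runs p) i) ∷ tagged ps is

  align : List (State m) → List Instruction → List (Tagged m)
  align []             _        = []
  align ((ps , ts) ∷ ss) []       = (tagged ps [] , ts) ∷ align ss []
  align ((ps , ts) ∷ ss) (i ∷ is) = (tagged ps i , ts) ∷ align ss is

  balancedᵇ : List (Tagged m) → Bool
  balancedᵇ = foldr (λ (zs , _) b → (weight ⊕ zs ≡ᵇ weight ⊝ zs) ∧ b) true

  next : List (Tagged m) → List (State m)
  next F = List.map proj₂ (deduplicate _≟ˢ_ (List.map mark
    (filter (λ s → solved s Bool.≟ false) (concatMap successors F))))

  -- A breadth-first check: the list holds the distinct unsolved states of one level, so the work is
  -- governed by the number of states and not by the number of branches of the decision tree.
  certified : ℕ → List (State m) → List (List Instruction) → Bool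
  certified _       []      _          = true
  certified (suc t) (s ∷ F) (is ∷ iss) =
    balancedᵇ (align (s ∷ F) is) ∧ certified t (next (align (s ∷ F) is)) iss
  certified _       _       _          = false

  -- A word describes a weighing: for each pile (piles are separated by dots) and each
  -- label, in order, two digits give the numbers of coins put on the left and on the
  -- right pan. The digit d has the character code 48 + d, so that 9 is followed by
  -- : ; < and so on; missing digits are zeros. There is one word for each state of a
  -- level, and levels are separated by slashes. The codes 32, 46 and 47 are those of
  -- space, dot and slash.
  parse : List String → List (List Instruction)
  parse =
    List.map (List.map instruction) ∘ List.linesByᵇ isSlash ∘ concatMap (List.wordsByᵇ (_≡ᵇ 32) ∘ codes)
    where
    codes : String → List ℕ
    codes = List.map toℕ ∘ toList
    isSlash : List ℕ → Bool
    isSlash w = does (List.≡-dec _≟_ w (47 ∷ []))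
    instruction : List ℕ → Instruction
    instruction = List.map (List.map (_∸ 48)) ∘ List.linesByᵇ (_≡ᵇ 46)

  box : ∀ m → ℕ → State m
  box m n = replicate m (List.replicate n 0) , replicate m 0 ∷ []

  -- Soundness of the check

  map-proj₁-tag : ∀ p w → List.map proj₁ (tag p w) ≡ p
  map-proj₁-tag []      _       = refl
  map-proj₁-tag (a ∷ p) []      = cong (a ∷_) (map-proj₁-tag p [])
  map-proj₁-tag (a ∷ p) (o ∷ w) = cong (a ∷_) (map-proj₁-tag p w)

  map-proj₁-tagged : (ps : Vec (List ℕ) m) (i : Instruction) → Vec.map (List.map proj₁) (tagged ps i) ≡ ps
  map-proj₁-tagged []       _        = refl
  map-proj₁-tagged (p ∷ ps) []       = cong₂ _∷_ (map-proj₁-tag p []) (map-proj₁-tagged ps [])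
  map-proj₁-tagged (p ∷ ps) (i ∷ is) =
    cong₂ _∷_ (map-proj₁-tag p (word (runs p) i)) (map-proj₁-tagged ps is)

  map⁻ : (f : A → B) (v : Vec B n) (xs : List A) → Vec.toList v ≡ List.map f xs →
         ∃[ w ] Vec.map f w ≡ v × Vec.toList {n = n} w ≡ xs
  map⁻ f []      []       refl = [] , refl , refl
  map⁻ f (b ∷ v) (x ∷ xs) e with List.∷-injective e
  ... | refl , e′ with map⁻ f v xs e′
  ... | w , refl , refl = x ∷ w , refl , refl

  -- A tagged state only prescribes how many coins of each label go to each pan. Lifting the
  -- permutation from labels to kinds chooses the actual coins to be weighed.
  refine : {ns : Vec ℕ m} (f : A → B) (vs : All (Vec B) ns) (zs : Vec (List A) m) →
           Realizes vs (Vec.map (List.map f) zs) →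
           ∃[ ws ] All.map (Vec.map f) ws ≡ vs × Realizes ws zs
  refine f []       []       _        = [] , refl , tt
  refine f (v ∷ vs) (z ∷ zs) (p , ps) with ↭.↭-map-inv f (↭-sym p) | refine f vs zs ps
  ... | xs , e , q | ws , refl , qs with map⁻ f v xs e
  ... | w , refl , refl = w ∷ ws , refl , ↭-sym q , qs

  ∣pan∣-weight : {ns : Vec ℕ m} (o : Outcome) (ws : All (Vec Kind) ns) (zs : Vec (List Kind) m) →
                 Realizes ws zs → ∣ pan o (All.map (Vec.map proj₂) ws) ∣ ≡ weight o zs
  ∣pan∣-weight o []       []       _        = refl
  ∣pan∣-weight o (w ∷ ws) (z ∷ zs) (p , ps) =
    cong₂ _+_ (trans (count w) (sum-↭ (↭.map⁺ _ p))) (∣pan∣-weight o ws zs ps)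
    where
    count : (w : Vec Kind n) → #[ o ] (Vec.map proj₂ w) ≡
            Σ (List.map (λ k → if o == proj₂ k then 1 else 0) (Vec.toList w))
    count []            = refl
    count ((_ , s) ∷ w) with o == s
    ... | true  = cong suc (count w)
    ... | false = count w

  relabel : {ns : Vec ℕ m} → Vec (A → B) m → All (Vec A) ns → All (Vec B) ns
  relabel []       []       = []
  relabel (f ∷ fs) (w ∷ ws) = Vec.map f w ∷ relabel fs ws

  labels-relabel : {ns : Vec ℕ m} (fs : Vec (Kind → ℕ) m) (ws : All (Vec Kind) ns)
                   (X : Configuration ns) →
                   labels (relabel fs ws) X ≡ rename fs (labels ws X)
  labels-relabel []       []       []      = refl
  labels-relabel (f ∷ fs) (w ∷ ws) (x ∷ X) = cong₂ _∷_ (Vec.lookup-map x f w) (labels-relabel fs ws X)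

  realizes-relabel : {ns : Vec ℕ m} (fs : Vec (Kind → ℕ) m) (ws : All (Vec Kind) ns)
                     (zs : Vec (List Kind) m) → Realizes ws zs →
                     Realizes (relabel fs ws) (Vec.zipWith (λ f z → sort (List.map f z)) fs zs)
  realizes-relabel []       []       []       _        = tt
  realizes-relabel (f ∷ fs) (w ∷ ws) (z ∷ zs) (p , ps) =
    ↭-trans (↭-reflexive (Vec.toList-map f w)) (↭-trans (↭.map⁺ f p) (↭-sym (sort-↭ (List.map f z)))) ,
    realizes-relabel fs ws zs ps

  lookup∈toList : (v : Vec A n) (x : Fin n) → lookup v x ∈ Vec.toList v
  lookup∈toList (a ∷ v) zero    = here refl
  lookup∈toList (a ∷ v) (suc x) = there (lookup∈toList v x)

  ∈-refinements : {ns : Vec ℕ m} (ws : All (Vec Kind) ns) (zs : Vec (List Kind) m)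
                  (X : Configuration ns) → Realizes ws zs →
                  labels ws X ∈ refinements (Vec.map (deduplicate _≟ᵏ_) zs) (Vec.map proj₁ (labels ws X))
  ∈-refinements []       []       []      _        = here refl
  ∈-refinements (w ∷ ws) (z ∷ zs) (x ∷ X) (p , ps) =
    ∈.∈-cartesianProductWith⁺ _∷_
      (∈.∈-filter⁺ (λ κ → proj₁ κ ≟ proj₁ (lookup w x))
        (∈.∈-deduplicate⁺ _≟ᵏ_ (↭.∈-resp-↭ p (lookup∈toList w x))) refl)
      (∈-refinements ws zs X ps)

  ∈-insert-new : (v : Vec ℕ m) (ws : List (Vec ℕ m)) → v ∈ insert v ws
  ∈-insert-new v []       = here refl
  ∈-insert-new v (w ∷ ws) with Vec.≡-dec _≟_ v w
  ... | yes v≡w = here v≡w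
  ... | no  _   with v <ˡ w
  ...   | true  = here refl
  ...   | false = there (∈-insert-new v ws)

  ∈-insert-old : (v : Vec ℕ m) {u : Vec ℕ m} (ws : List (Vec ℕ m)) → u ∈ ws → u ∈ insert v ws
  ∈-insert-old v (w ∷ ws) u∈ with Vec.≡-dec _≟_ v w
  ... | yes _ = u∈
  ... | no  _ with v <ˡ w | u∈
  ...   | true  | u∈       = there u∈
  ...   | false | here e   = here e
  ...   | false | there u∈ = there (∈-insert-old v ws u∈)

  ∈-sorted : {u : Vec ℕ m} (ws : List (Vec ℕ m)) → u ∈ ws → u ∈ foldr insert [] ws
  ∈-sorted (w ∷ ws) (here refl) = ∈-insert-new w (foldr insert [] ws)
  ∈-sorted (w ∷ ws) (there u∈)  = ∈-insert-old w (foldr insert [] ws) (∈-sorted ws u∈)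

  -- The relabelling `fs` is arbitrary because renaming can only enlarge the set of configurations
  -- compatible with the list of vectors, and a strategy for a larger set also serves a smaller one.
  solvable-step : (zs : Vec (List Kind) m) (ts : List (Vec ℕ m)) (fs : Outcome → Vec (Kind → ℕ) m) →
                  weight ⊕ zs ≡ weight ⊝ zs →
                  (∀ o → SolvableState (relabelled zs (after o (refined zs ts)) (fs o)) t) →
                  SolvableState (Vec.map (List.map proj₁) zs , ts) (suc t)
  solvable-step {m} zs ts fs even ih vs real with refine proj₁ vs zs real
  ... | ws , refl , real′ = weigh-on w λ o →
    solvableOn-⊆ (λ X (∈ts , e) → subst (_∈ _) (sym (labels-relabel (fs o) ws X))
                   (∈-sorted _ (∈.∈-map⁺ (rename (fs o)) (survives o X ∈ts e))))
                 (ih o (relabel (fs o) ws) (realizes-relabel (fs o) ws zs real′))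
    where
    a = All.map (Vec.map proj₂) ws
    balance : ∣ pan ⊕ a ∣ ≡ ∣ pan ⊝ a ∣
    balance = trans (∣pan∣-weight ⊕ ws zs real′) (trans even (sym (∣pan∣-weight ⊝ ws zs real′)))
    w = place a balance
    survives : ∀ o X → labels (All.map (Vec.map proj₁) ws) X ∈ ts → outcome w X ≡ o →
               labels ws X ∈ after o (refined zs ts)
    survives o X ∈ts e = ∈.∈-filter⁺ (λ r → result r ≟ᵒ o)
      (∈.∈-concatMap⁺ (refinements (Vec.map (deduplicate _≟ᵏ_) zs))
        (lose (subst (_∈ ts) (labels-map proj₁ ws X) ∈ts) (∈-refinements ws zs X real′)))
      (trans (cong tally (sym (labels-map proj₂ ws X))) (trans (sym (outcome-place a balance X)) e))

  ∧-true : ∀ {a b} → a ∧ b ≡ true → a ≡ true × b ≡ true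
  ∧-true {true} {true} refl = refl , refl

  lookup-occurs : (v : Vec ℕ n) (a : ℕ) (x : Fin n) → lookup v x ≡ a →
                  length (filter (_≟ a) (Vec.toList v)) ≢ 0
  lookup-occurs (b ∷ v) a x e p with b ≡ᵇ a in b≡ᵇa
  lookup-occurs (b ∷ v) a x       e () | true
  lookup-occurs (b ∷ v) a zero    e p  | false = subst T b≡ᵇa (≡⇒≡ᵇ b a e)
  lookup-occurs (b ∷ v) a (suc x) e p  | false = lookup-occurs v a x e p

  lookup-unique : (v : Vec ℕ n) (a : ℕ) (x y : Fin n) → lookup v x ≡ a → lookup v y ≡ a →
                  length (filter (_≟ a) (Vec.toList v)) ≤ 1 → x ≡ y
  lookup-unique (b ∷ v) a x y d e p with b ≡ᵇ a in b≡ᵇa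
  lookup-unique (b ∷ v) a zero    zero    d e p | _     = refl
  lookup-unique (b ∷ v) a zero    (suc y) d e p | true  =
    contradiction (n≤0⇒n≡0 (s≤s⁻¹ p)) (lookup-occurs v a y e)
  lookup-unique (b ∷ v) a zero    (suc y) d e p | false = contradiction (≡⇒≡ᵇ b a d) (subst T b≡ᵇa)
  lookup-unique (b ∷ v) a (suc x) zero    d e p | true  =
    contradiction (n≤0⇒n≡0 (s≤s⁻¹ p)) (lookup-occurs v a x d)
  lookup-unique (b ∷ v) a (suc x) zero    d e p | false = contradiction (≡⇒≡ᵇ b a e) (subst T b≡ᵇa)
  lookup-unique (b ∷ v) a (suc x) (suc y) d e p | true  =
    contradiction (n≤0⇒n≡0 (s≤s⁻¹ p)) (lookup-occurs v a x d)
  lookup-unique (b ∷ v) a (suc x) (suc y) d e p | false = cong suc (lookup-unique v a x y d e p)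

  uniqueᵇ-sound : {ns : Vec ℕ m} (vs : All (Vec ℕ) ns) (ps : Vec (List ℕ) m) (t : Vec ℕ m)
                  (X Y : Configuration ns) → Realizes vs ps → uniqueᵇ ps t ≡ true →
                  labels vs X ≡ t → labels vs Y ≡ t → X ≡ Y
  uniqueᵇ-sound []       []       []      []      []      _        _ _ _ = refl
  uniqueᵇ-sound (v ∷ vs) (p ∷ ps) (a ∷ t) (x ∷ X) (y ∷ Y) (r , rs) u d e
    with ∧-true u | Vec.∷-injective d | Vec.∷-injective e
  ... | u₁ , u₂ | d₁ , d₂ | e₁ , e₂ = cong₂ _∷_
    (lookup-unique v a x y d₁ e₁ (subst (_≤ 1) (sym (↭.↭-length (↭.filter-↭ (_≟ a) r)))
      (≤ᵇ⇒≤ _ 1 (subst T (sym u₁) tt))))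
    (uniqueᵇ-sound vs ps t X Y rs u₂ d₂ e₂)

  solved-sound : (s : State m) → solved s ≡ true → SolvableState s t
  solved-sound (ps , [])     _ vs real = stop , λ { _ _ () }
  solved-sound (ps , t ∷ []) u vs real =
    stop , λ { X Y (here d) (here e) _ → uniqueᵇ-sound vs ps t X Y real u d e }

  align-∈ : {ps : Vec (List ℕ) m} {ts : List (Vec ℕ m)} (F : List (State m)) (is : List Instruction) →
            (ps , ts) ∈ F → ∃[ zs ] Vec.map (List.map proj₁) zs ≡ ps × (zs , ts) ∈ align F is
  align-∈ {ps = ps} (_ ∷ F) []       (here refl) = tagged ps [] , map-proj₁-tagged ps [] , here refl
  align-∈ {ps = ps} (_ ∷ F) (i ∷ is) (here refl) = tagged ps i , map-proj₁-tagged ps i , here refl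
  align-∈ (_ ∷ F) []       (there s∈) = let zs , e , zs∈ = align-∈ F [] s∈ in zs , e , there zs∈
  align-∈ (_ ∷ F) (i ∷ is) (there s∈) = let zs , e , zs∈ = align-∈ F is s∈ in zs , e , there zs∈

  balancedᵇ-sound : {zs : Vec (List Kind) m} {ts : List (Vec ℕ m)} (F : List (Tagged m)) →
                    balancedᵇ F ≡ true → (zs , ts) ∈ F → weight ⊕ zs ≡ weight ⊝ zs
  balancedᵇ-sound (_ ∷ F) b (here refl) = ≡ᵇ⇒≡ _ _ (subst T (sym (proj₁ (∧-true b))) tt)
  balancedᵇ-sound (_ ∷ F) b (there s∈)  = balancedᵇ-sound F (proj₂ (∧-true b)) s∈

  -- Each successor is either solved or found again in the next level, since `next` drops only
  -- solved and repeated states.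
  certified-sound : ∀ t (F : List (State m)) iss → certified t F iss ≡ true →
                    ∀ {s} → s ∈ F → SolvableState s t
  certified-sound (suc t) F@(_ ∷ _) (is ∷ iss) c {ps , ts} s∈ with align-∈ F is s∈ | ∧-true c
  ... | zs , refl , zs∈ | b , c′ =
    solvable-step zs ts (λ o → newLabels (after o rs) zs) (balancedᵇ-sound (align F is) b zs∈) branch
    where
    rs = refined zs ts
    ∈successors : ∀ o → successor zs rs o ∈ successors (zs , ts)
    ∈successors ⊕ = here refl
    ∈successors ⊙ = there (here refl)
    ∈successors ⊝ = there (there (here refl))
    branch : ∀ o → SolvableState (successor zs rs o) t
    branch o with solved (successor zs rs o) in e
    ... | true  = solved-sound (successor zs rs o) e
    ... | false = certified-sound t (next (align F is)) iss c′
      (∈.∈-map⁺ proj₂ (∈.∈-deduplicate⁺ _≟ˢ_ (∈.∈-map⁺ mark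
        (∈.∈-filter⁺ (λ s → solved s Bool.≟ false) (∈.∈-concatMap⁺ successors (lose zs∈ (∈successors o))) e))))

  zeros : (ns : Vec ℕ m) → All (Vec ℕ) ns
  zeros []       = []
  zeros (n ∷ ns) = replicate n 0 ∷ zeros ns

  -- For concrete arguments the equation is proved by `refl`, that is, by running the check during
  -- type checking.
  solvable-certified : ∀ m n t cs → certified t (box m n ∷ []) (parse cs) ≡ true →
                       Solvable (replicate m n) t
  solvable-certified m n t cs c =
    let A , h = certified-sound t (box m n ∷ []) (parse cs) c (here refl)
                  (zeros (replicate m n)) (realizes m)
    in A , λ X Y → h X Y (here (labels-zeros m X)) (here (labels-zeros m Y))
    where
    realizes : ∀ m → Realizes (zeros (replicate m n)) (replicate m (List.replicate n 0))
    realizes zero    = tt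
    realizes (suc m) = ↭-reflexive (Vec.toList-replicate n 0) , realizes m
    labels-zeros : ∀ m (X : Configuration (replicate m n)) → labels (zeros (replicate m n)) X ≡ replicate m 0
    labels-zeros zero    []      = refl
    labels-zeros (suc m) (x ∷ X) = cong₂ _∷_ (Vec.lookup-replicate x 0) (labels-zeros m X)

  open import Data.Integer.Base using (+_)

  -- The claimed bounds

  -- If n ≤ d, then both logarithms may be nonpositive and equal.
  ⌈log₃⌉-third : ∀ n q d .{{_ : NonZero n}} .{{_ : NonZero q}} .{{_ : NonZero d}} → d < n → 3 * q ≤ 2 + n →
                 ⌈log₃ q / d ⌉ ℤ.+ + 1 ℤ.≤ ⌈log₃ n / d ⌉
  ⌈log₃⌉-third n q d d<n 3q≤2+n with ⌈log₃ n / d ⌉ | ⌈log₃⌉-upper n d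
  ... | + zero | n≤d = contradiction (subst (n ≤_) (*-identityʳ d) n≤d) (<⇒≱ d<n)
  ... | -[1+ k ] | n3ᵏ≤d = contradiction (≤-trans (m≤m*n n (3 ^ suc k) {{m^n≢0 3 (suc k)}}) n3ᵏ≤d) (<⇒≱ d<n)
  ... | + suc k | n≤d3ᵏ = begin
    ⌈log₃ q / d ⌉ ℤ.+ + 1 ≤⟨ ℤ.+-monoˡ-≤ (+ 1) (⌈log₃⌉-least q d (+ k) (≮⇒≥ q≯)) ⟩
    + (k + 1)             ≡⟨ cong +_ (+-comm k 1) ⟩
    + suc k               ∎
    where
    open ℤ.≤-Reasoning
    d3ᵏ⁺¹ : d * 3 ^ suc k ≡ 3 * (d * 3 ^ k)
    d3ᵏ⁺¹ = trans (sym (*-assoc d 3 (3 ^ k))) (trans (cong (_* 3 ^ k) (*-comm d 3)) (*-assoc 3 d (3 ^ k)))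
    q≯ : d * 3 ^ k ≮ q
    -- With `e = d * 3 ^ k`, assuming `e < q` gives `3e + 3 ≤ 3q ≤ 2 + n ≤ 2 + 3e`: rounding up adds
    -- at most 2 and cannot pass the multiple `3e` of 3.
    q≯ d3ᵏ<q = 1+n≰n (≤-trans (subst (_≤ 3 * q) (*-suc 3 (d * 3 ^ k)) (*-monoʳ-≤ 3 d3ᵏ<q))
                              (≤-trans 3q≤2+n (+-monoʳ-≤ 2 (subst (n ≤_) d3ᵏ⁺¹ n≤d3ᵏ))))

  -- The denominators are given by their predecessors.
  logSum : ℤ → ∀ n .{{_ : NonZero n}} → Vec ℕ k → ℤ
  logSum a n []       = a
  logSum a n (d ∷ ds) = logSum (a ℤ.+ ⌈log₃ n / suc d ⌉) n ds

  -- Here `j` is the gain of the terms already absorbed into the accumulators `a` and `b`; each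
  -- further denominator adds one to it.
  logSum-third : ∀ n q .{{_ : NonZero n}} .{{_ : NonZero q}} (ds : Vec ℕ k) {a b} j →
                 3 * q ≤ 2 + n → All (λ d → suc d < n) ds → a ℤ.+ + j ℤ.≤ b →
                 logSum a q ds ℤ.+ + (k + j) ℤ.≤ logSum b n ds
  logSum-third n q []       j _      _        a≤b = a≤b
  logSum-third n q (_∷_ {n = k} d ds) {a} {b} j 3q≤2+n (d< ∷ ds<) a≤b =
    subst (λ i → logSum (a ℤ.+ z) q ds ℤ.+ + i ℤ.≤ logSum (b ℤ.+ ⌈log₃ n / suc d ⌉) n ds)
          (+-suc k j)
          (logSum-third n q ds (suc j) 3q≤2+n ds< step)
    where
    open ℤ.≤-Reasoning
    z = ⌈log₃ q / suc d ⌉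
    step : (a ℤ.+ z) ℤ.+ + suc j ℤ.≤ b ℤ.+ ⌈log₃ n / suc d ⌉
    step = begin
      (a ℤ.+ z) ℤ.+ + suc j          ≡⟨ cong (λ i → (a ℤ.+ z) ℤ.+ + i) (+-comm 1 j) ⟩
      (a ℤ.+ z) ℤ.+ (+ j ℤ.+ + 1)    ≡⟨ ℤ.+-assoc a z _ ⟩
      a ℤ.+ (z ℤ.+ (+ j ℤ.+ + 1))    ≡⟨ cong (λ y → a ℤ.+ y) (ℤ.+-assoc z (+ j) (+ 1)) ⟨
      a ℤ.+ ((z ℤ.+ + j) ℤ.+ + 1)    ≡⟨ cong (λ y → a ℤ.+ (y ℤ.+ + 1)) (ℤ.+-comm z (+ j)) ⟩
      a ℤ.+ ((+ j ℤ.+ z) ℤ.+ + 1)    ≡⟨ cong (λ y → a ℤ.+ y) (ℤ.+-assoc (+ j) z (+ 1)) ⟩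
      a ℤ.+ (+ j ℤ.+ (z ℤ.+ + 1))    ≡⟨ ℤ.+-assoc a (+ j) _ ⟨
      (a ℤ.+ + j) ℤ.+ (z ℤ.+ + 1)    ≤⟨ ℤ.+-mono-≤ a≤b (⌈log₃⌉-third n q (suc d) d< 3q≤2+n) ⟩
      b ℤ.+ ⌈log₃ n / suc d ⌉        ∎

  -- The denominator 1 stands apart, hence `k` entries for `suc k` piles. The accumulator of
  -- `logSum` reproduces the left-nested sums of the theorem, so that the final bounds match by
  -- computation.
  logBound : Vec ℕ k → ℕ → ∀ n .{{_ : NonZero n}} → ℤ
  logBound ds c n = logSum ⌈log₃ n / 1 ⌉ n ds ℤ.+ + c

  Bounded : Vec ℕ k → ℕ → ∀ n .{{_ : NonZero n}} → Set
  Bounded {k} ds c n = + g₁ (replicate (suc k) n) ℤ.≤ logBound ds c n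

  -- Kept apart from Bounded, since comparing two types that mention g₁ at concrete
  -- numbers would start its exhaustive search.
  record Base {k} (ds : Vec ℕ k) (c n : ℕ) .{{_ : NonZero n}} : Set where
    constructor base
    field
      {weighings} : ℕ
      solvable    : Solvable (replicate (suc k) n) weighings
      {enough}    : True (+ weighings ℤ.≤? logBound ds c n)

  base⇒bounded : (ds : Vec ℕ k) (c n : ℕ) .{{_ : NonZero n}} → Base ds c n → Bounded ds c n
  base⇒bounded {k} ds c n (base s {t≤}) =
    ℤ.≤-trans (ℤ.+≤+ (g₁-least (replicate (suc k) n) _ s)) (toWitness t≤)

  bounded-triple : ∀ n q .{{_ : NonZero n}} .{{_ : NonZero q}} (ds : Vec ℕ k) c →
                   n ≤ 3 * q → 3 * q ≤ 2 + n → 1 < n → All (λ d → suc d < n) ds →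
                   Bounded ds c q → Bounded ds c n
  bounded-triple {k} n q ds c n≤3q 3q≤2+n 1<n ds<n bound = begin
    + g₁ (replicate (suc k) n)                     ≤⟨ ℤ.+≤+ (g₁-least _ _ tripled) ⟩
    + (suc k + g₁ (replicate (suc k) q))           ≤⟨ ℤ.+-monoʳ-≤ (+ suc k) bound ⟩
    + suc k ℤ.+ (logSum l q ds ℤ.+ + c)            ≡⟨ ℤ.+-assoc (+ suc k) (logSum l q ds) (+ c) ⟨
    (+ suc k ℤ.+ logSum l q ds) ℤ.+ + c            ≡⟨ cong (λ y → y ℤ.+ + c) (ℤ.+-comm (+ suc k) (logSum l q ds)) ⟩
    (logSum l q ds ℤ.+ + suc k) ℤ.+ + c            ≡⟨ cong (λ i → (logSum l q ds ℤ.+ + i) ℤ.+ + c) (+-comm 1 k) ⟩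
    (logSum l q ds ℤ.+ + (k + 1)) ℤ.+ + c          ≤⟨ ℤ.+-monoˡ-≤ (+ c) decreases ⟩
    logBound ds c n                                ∎
    where
    open ℤ.≤-Reasoning
    l = ⌈log₃ q / 1 ⌉
    tripled : Solvable (replicate (suc k) n) (suc k + g₁ (replicate (suc k) q))
    tripled = solvable-triple n q n≤3q (g₁-solvable (replicate (suc k) q))
    decreases : logSum l q ds ℤ.+ + (k + 1) ℤ.≤ logSum ⌈log₃ n / 1 ⌉ n ds
    -- The leading logarithm contributes the first unit, hence `j = 1`; together the `suc k`
    -- logarithms pay for the `suc k` weighings of thirds.
    decreases = logSum-third n q ds 1 3q≤2+n ds<n (⌈log₃⌉-third n q 1 1<n 3q≤2+n)

  -- Both numbers are shifted by one to suit an induction over predecessors: `suc q` is a third of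
  -- `suc n`, rounded up.
  third : ∀ n → ∃[ q ] suc n ≤ 3 * suc q × 3 * suc q ≤ 3 + n
  third 0 = 0 , s≤s z≤n , ≤-refl
  third 1 = 0 , s≤s (s≤s z≤n) , s≤s (s≤s (s≤s z≤n))
  third 2 = 0 , ≤-refl , s≤s (s≤s (s≤s z≤n))
  third (suc (suc (suc n))) with third n
  ... | q , lo , hi = suc q , subst (4 + n ≤_) (sym (*-suc 3 (suc q))) (+-monoʳ-≤ 3 lo) ,
                              subst (_≤ 6 + n) (sym (*-suc 3 (suc q))) (+-monoʳ-≤ 3 hi)

  bounded : (ds : Vec ℕ k) (c b : ℕ) → 1 ≤ b → All (_< b) ds →
            ListAll.All (λ i → Base ds c (suc i)) (upTo b) → ∀ n .{{_ : NonZero n}} → Bounded ds c n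
  bounded ds c b 1≤b ds<b bases (suc n) = <-rec (λ i → Bounded ds c (suc i)) step n
    where
    step : ∀ i → (∀ {j} → j < i → Bounded ds c (suc j)) → Bounded ds c (suc i)
    step i ih with i <? b
    -- As `i` is the predecessor of the number of coins, this covers up to `b` coins per pile;
    -- otherwise `suc d ≤ b ≤ i < suc i` for every denominator `suc d`.
    ... | yes i<b = base⇒bounded ds c (suc i) (ListAll.lookup bases (∈.∈-upTo⁺ i<b))
    ... | no  i≮b =
      let q , lo , hi = third i
          b≤i = ≮⇒≥ i≮b
          1≤i = ≤-trans 1≤b b≤i
      in bounded-triple (suc i) (suc q) ds c lo hi (s≤s 1≤i)
           (All.map (λ d<b → s≤s (≤-trans d<b b≤i)) ds<b) (ih (smaller 1≤i hi))
      where
      smaller : ∀ {q} → 1 ≤ i → 3 * suc q ≤ 3 + i → q < i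
      smaller {q} 1≤i hi = ≰⇒> λ i≤q → contradiction
        (+-cancelˡ-≤ (3 + i) (2 * i) 0 (begin
          3 + i + 2 * i ≡⟨ *-suc 3 i ⟨
          3 * suc i     ≤⟨ *-monoʳ-≤ 3 (s≤s i≤q) ⟩
          3 * suc q     ≤⟨ hi ⟩
          3 + i         ≡⟨ +-identityʳ (3 + i) ⟨
          3 + i + 0     ∎))
        (<⇒≱ (≤-trans 1≤i (m≤m+n i (1 * i))))
        where open ≤-Reasoning

  -- The small cases

  triple : ∀ N {n} → Solvable (replicate m N) t → {True (n ≤? 3 * N)} → Solvable (replicate m n) (m + t)
  triple N s {n≤} = solvable-triple _ N (toWitness n≤) s

  below : ∀ {i n} {i<n : True (i <? n)} → i < n
  below {i<n = i<n} = toWitness i<n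

  -- Each certified number of weighings equals the claimed bound. A strategy is certified precisely
  -- where tripling the one used for a third of the coins, rounded up, would exceed that bound. Here
  -- the first word puts three coins of the second pile against two of the first and the fourth of
  -- the second.
  solvable-2-4 : Solvable (replicate 2 4) 3
  solvable-2-4 = solvable-certified 2 4 3
    ( "02.31 / .11 11 / 11"
    ∷ [] ) refl

  solvable-2-5 : Solvable (replicate 2 5) 3
  solvable-2-5 = solvable-certified 2 5 3
    ( "23.21 / 0101.31 .1001 11 / .11 11 11"
    ∷ [] ) refl

  solvable-3-2 : Solvable (replicate 3 2) 2
  solvable-3-2 = solvable-certified 3 2 2
    ( "01.11.10 / 0001..0010 1001.0001.10 10..01"
    ∷ [] ) refl

  solvable-3-4 : Solvable (replicate 3 4) 4
  solvable-3-4 = solvable-certified 3 4 4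
    ( "13.02.40 / 0020.02 11 / 0001.01.31 / ..11 .11"
    ∷ [] ) refl

  solvable-4-2 : Solvable (replicate 4 2) 3
  solvable-4-2 = solvable-certified 4 2 3
    ( ".02.11.20 / 01.10..11 / 10.01 10.0001 10.01"
    ∷ [] ) refl

  solvable-4-4 : Solvable (replicate 4 4) 6
  solvable-4-4 = solvable-certified 4 4 6
    ( "22.04.40 / 0202.40.22 / 0101.40..13 / 11 ...11 / 0001.31.01 / .11 ..11"
    ∷ [] ) refl

  solvable-4-5 : Solvable (replicate 4 5) 6
  solvable-4-5 = solvable-certified 4 5 6
    ( "..22.11 / ..11.11 .05.0220.301010 / ...11 ...001001 .50.1103.0002 / 12.32 / 11 11"
    ∷ "1310.10 / .11 .11 11"
    ∷ [] ) refl

  solvable-4-10 : Solvable (replicate 4 10) 9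
  solvable-4-10 = solvable-certified 4 10 9
    ( "55 / 0010.05..73 / 0502..33.70 ...11 / ..11 .12..43 3240.05 / 0010.12 .11 0020.10..0003"
    ∷ "...11 3050.02.28 2070.05.37 / ...22 0002.01..52 2001..10.13 0201..30 0210.01.31 .22 ..33"
    ∷ "..33 0105.82 0102..52 / 22 22 12...32 4102.10..02 032050.0010.03.0310 0001..0310.30 11"
    ∷ "...11 11 002010.03.11 030001.0010.30 11 11 11 11 .33 ..11 .12.32 1002.41.02 / 11 ...11"
    ∷ "...11 ...11 11 010001...0020 3101...01 .11 1010..13 000101...3001 11 ..11 11 .11 3011.03"
    ∷ "11 .11 ..11 .11 ..11 11 0001.11.3002 0001.31.01 11 / ...11 11 ...11 11 ..11 .11 ..11 .11"
    ∷ [] ) refl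

  solvable-4-11 : Solvable (replicate 4 11) 9
  solvable-4-11 = solvable-certified 4 11 9
    ( "0;.44..;0 / .1303.50 .0010.56 / ..33 .11 ..22 / 0;..11.;0 44.0006.05.;0 92.0308.0102.92"
    ∷ "/ ...33 0010...34 1160..50.0; 33 .11 / 44 38.0030..20 31..02 3110..02.01 0030..20.38"
    ∷ "...33 9020.0003.01.1811 / 11 11 ...22 33 33 11 11 ..22 11 110030..0320.0310 ...33 ...33"
    ∷ "11 9002.0006.01 9001.0008 / ...11 ...11 11 11 11 11 ..11 ...11 0002..3001 3101..01 ..11"
    ∷ "..11 .11 33 10..01.11 ...33 / 11 ...11 ...11 ..11 ..11 11 10..01 100001 0001..0010"
    ∷ [] ) refl

  solvable-4-19 : Solvable (replicate 4 19) 11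
  solvable-4-19 = solvable-certified 4 19 11
    ( "..88 / .66.44 66 / .4906.0206.C0 0C.2222..C0 .66 .66 / .31.02 .33:0.2070.0C"
    ∷ ".1000>0.1140.0C ...66 ...66 ...66 ...66 / .11 .0020.02 .001020.0201 ..11 22 ...22 .22"
    ∷ ".22 22 22 22 22 / 66...66 66...77 .22 22 22 22 22 ...22 ...22 .22 ...22 ...22 .22 .22"
    ∷ ".22 .22 / 703306..01 070560.0001.11.200050 345160.1020..0705 152230.020@..707050 ...22"
    ∷ ".22 .22 ...22 22 22 22 22 ...22 .22 .22 ...22 ...22 ...22 ...22 ...22 / 11...0033 11"
    ∷ "70002010.0005..2205 02423001.0002 22110110...003201 230002...1020 000001.01..5223"
    ∷ ".01..703405 502006.01..6105 ..11 ..11 .11 .11 11 11 11 11 / 33 000010...23 0040..10.49"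
    ∷ "34600101...010101 2211 041130..0010.22 2101...2310 10200020..1001.2205 201030...0721"
    ∷ "31100140...070010 001050...2910 11...22 ...33 3001...02 2201.10 0011...22"
    ∷ "000040.10..0522 ...22 11 ...11 ..11 ..11 ..11 ..11 .11 .11 / 11 11...11 0010..10.13"
    ∷ "...33 300003...0110 13...1010 100103...2010 31...0101 11010001...20 010020..0010.13"
    ∷ "3101...01 11...22 010001...31 0211...20 100010...13 10.11..01 100102...1010 .11 11 11"
    ∷ "...11 ...11 ..11 ..11 / ...11 0001...10 ..11 11 0010...0001 ...11 0001..10.0110 ...11"
    ∷ "000010.01 01...10 .11 11"
    ∷ [] ) refl

  solvable-4-20 : Solvable (replicate 4 20) 11
  solvable-4-20 = solvable-certified 4 20 11
    ( "77.0D.D0 / 22..66 22..0D.D0 / 000005..8003 00000020..400622 .D0.66.0D / 0003.D0.23.2B"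
    ∷ ".0D.11.D0 00000;.D0.0420.29 020009..0302.B2 .0D.22.D0 / 10?0...0B20 10B0.0D.21"
    ∷ "0040.=7..0: 0010?0...0B20 ...33 0000?0..0010.0B20 000?..01.B2 / 0030..26.10 ...66 ...66"
    ∷ ".49..50 .22..77 000010..0420.10 030A.D0..11 200207..6020.01 .77 / 2001...01 1010..24"
    ∷ "...22 ...22 0003.13..50 .33 0003.0002..50 0003...107005 2110..02 .22 .22 / 01.77.10"
    ∷ ".77.11 .77.01.10 01.77..10 0050...05 05.11..50 2210.0311..0020 22.11..11 22.0011..22"
    ∷ ".3010..15 11 .11 / 0010.0022.0001 01000;.707024 01.0022.10 .0022.11 0002.257024.021010"
    ∷ "0001.0022.0110.10 00;0.070742..10 .0022.01.10 011001.0022..10 01000;.707024"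
    ∷ "001001.0022..1001 22...11 000010...1310 20000102.30..2301 02020140.1001..300101"
    ∷ "00000030.10..240101 ...33 0201.10..301101 00001020.11..030011 2220.0311..0010 .11 11 /"
    ∷ ".2211 .33 0010.13.10 .2211 010010.13.1010 .33 0001.3102.10 0001.31.01 0010.3102..01"
    ∷ "0010.13.0010 .2211 100010.13..1001 0101...3001 0202...3010 100001...1001 11 11...11"
    ∷ "100020.03 300102 01...3101 11.0110..1001 11 01010001...30 0011...0110"
    ∷ "00020020.000101..1010 ..11 / .11 .11 .01.0010 000110..1001 ..11 .11 ...0110"
    ∷ "000001...0010 ...11 11 11 11.1001 .01..10 11 010010...1001 010010.0001..10 ...11"
    ∷ [] ) refl

  solvable-5-2 : Solvable (replicate 5 2) 4
  solvable-5-2 = solvable-certified 5 2 4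
    ( "11 / 0010.10..02 / ..11.10.01 / 0001...0110.0010 ...0110 0010...01.0110"
    ∷ [] ) refl

  solvable-5-4 : Solvable (replicate 5 4) 7
  solvable-5-4 = solvable-certified 5 4 7
    ( "22 / .20...13 / 0020.20..04 ....11 / 0001.01..31 / ...11 .11 / 0101..31 / ..11 11"
    ∷ [] ) refl

  solvable-5-5 : Solvable (replicate 5 5) 8
  solvable-5-5 = solvable-certified 5 5 8
    ( "..11 / . .50.11.05 / 50.12.0001.14 / .22..11 .0101..31 / .11 ...11 50.0110...05 /"
    ∷ "32....12 / 11 ....1001 0101....31 / ....11 11 11"
    ∷ [] ) refl

  solvable-5-7 : Solvable (replicate 5 7) 9
  solvable-5-7 = solvable-certified 5 7 9
    ( "70.13..16 / .0001..0010 .11 / .22.07..70 22 ...22 / 33..22 ..22 ..22 22....22 /"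
    ∷ "300001.02.3001..13 11.0002.3001 ....22 ....22 ....22 ....22 000020...10.0311"
    ∷ "300202.0030.13..000220 / 0001.01...3001 030101.01.300010..003001 031010.10"
    ∷ "000002.01...52 000002.01...52 11 ....11 ..11 ..11 11 11 11 11 5001..25.01"
    ∷ "000201..52..0110 000020..3001.10.0302 ..0030.01.0002 001101...01.1010 / 11 30.01.13"
    ∷ "000001.01...3001 0020.10...2401 0301..0010..30 000102..0020..21 .01.3002"
    ∷ "000002..2001..21 000002..2001..10 ..11 11 11 ....11 ....11 ..11 ..11 4102...01 21..23"
    ∷ "302001..2301..0101 1001....2101 03...10.0020 ..11 000020..0002.1001.0110"
    ∷ "00000120..0430.1001 000040..0401.10.0110 / ..11 11 11 11 000010.01.0110 .11.10..01"
    ∷ "0010..10..1201 0010..11..12 100001....0110 ..11 ....0110 ....11 ..11 11 ....11 3101..01"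
    ∷ "..11 101010..03 11..10..01 0011 0010..0310..10 11...01.10 000001..31..0001"
    ∷ "200001..1111..0001 0010..13.10 11 000010..13.0001.1010 0010..13.0010 / ....11 .11 ..11"
    ∷ "11 0001..0010..0110 0001.10 ..0001..0010 ..0110..11 ....11 ..11 ...11 001001..0110"
    ∷ "0010...1001.0001 001001 ...0010.0001 1001..10..01 0001..10.0110 ..1001"
    ∷ [] ) refl

  solvable-5-10 : Solvable (replicate 5 10) 11
  solvable-5-10 = solvable-certified 5 10 11
    ( ":0..33..0: / .50.0302 .05.3130 / ..11 .05.0050 / 82.0505.0001..50 / 04.05..73.50"
    ∷ "0110...0:.:0 / 0001.05..61.21 ...11 0003...91.05 / ...22 2005....4001 0420.50...14 ...33"
    ∷ "....33 / 1301.30..10.01 0110.02...31 0101.50..25 33 ...11 .22 .22 /"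
    ∷ "110010.3002..0001.0001 .0320..0010 0020.0310 11 ....11 000120.0002...0010 0120.14..20"
    ∷ ".21..23 .22 .22 .23...21 ....11 ....11 ....11 ....11 / 11 10...0001 0002.3001"
    ∷ "000001.01..1010.0110 3001...01.0001 .11 300010.0301 0001.01...31 11 0001.31..01"
    ∷ "0010.10..0002 .11 11 11 11 11 ....11 .11 .11 ....11 / .11 ...01.10 .11 11 ....11 ...11"
    ∷ "...11 ....11"
    ∷ [] ) refl

  solvable-5-11 : Solvable (replicate 5 11) 11
  solvable-5-11 = solvable-certified 5 11 11
    ( "33.44 / 1403.4030.34 000330.4004.11 / 00000010..2311 130004.043004..;0"
    ∷ "000003.0403..;0.34 ..33 / ....44 00000003.000004.120101.;0.34 000060..40.34.1: 11.04.40"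
    ∷ "....11 0011.0011 0060.1120.30..0; / 04301020....02 ....11 400310.02 000001...3211"
    ∷ "300060.04.04.40.05 0080.40..34.0; 051102.0411.:010 ..44..22 0506..11..;0 /"
    ∷ "1101.1101.2010..01 0020.13..15.40 00000010.2003 000040.10...2612 ....11 001001..13..1010"
    ∷ "000007.2011.04..9110 11 0030.31...05 0070..40.11.0; 0005.02.04.31.:1 501050..55.0;"
    ∷ "310105.120006..;0.11 0002.04..51.2011 0010...34 / .2211..44 0100000104.002020..20"
    ∷ "00000004.000001.02.92 ...55 .11 340110.10 ...44 000001.01.200110 400002..02.92.0502"
    ∷ "1140.70..0; 300020.0403..3010.000101 001070.000010.11..09 ....33 100003.0010..2001"
    ∷ "000007.402001.20 .11 0040..04..55 0010..02..65 ...11 0070.20...0:10 0010.20..47"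
    ∷ "500002.0410..33 .11..44 .11..44 010020..2210.02 ....1001 0004...5001 ...11 05...40.43 /"
    ∷ "0000000001.200001.20.13 0000011020.0220.02 00000050.0010..0920.0010"
    ∷ "0000010010.001101...0010 ..11 00100106.000201..90.1001 ...33 00010007.0010.01.9002.0010"
    ∷ "1301...20.10 .31...02 0060.10..29 401002..2001.15 ...11 11 0060.10..29 ...33"
    ∷ "0001....3101 000002..110010..3101 0020.43..25 ....33 000010.22..0001.000110"
    ∷ "0001.11.13.30 11 001001.20.13.0001.0010 10..13..32 .10.13..32 000103..40 11"
    ∷ "0001..13.10.20 0002.40.02..22 0001.13.11..30 .02..31 0001.10.20.13 0020.10..25 ...55 .11"
    ∷ "...33 00000050.000010.06.3003 30010004..1501.004030 ..33.22 010101.101010.0110.4004"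
    ∷ "...33 000002..200110 000108.30.0001.9002 0001.13.11.30 0020.02.0422..2020 2030....38"
    ∷ "2001...10.13 20...10.03 / 00000020.0101.02.3001 00000001.011010 0010011003.1001.20"
    ∷ "00000003.1010..1330 00000010.100001.01..1001 00010030.04..10.10 .11 .11 000080...0910"
    ∷ "0002.1010...0110 ...33 01100001.10.02.30.0001 ..01..0010 00000080...0910"
    ∷ ".00000010..01.0110 000001...0002.30 0002...3001 11 13.30...01 0220 11 ...33"
    ∷ "000060..10.1910 12...32 11 11 .11 ....11 ...33 ...11 000006.0002..9001"
    ∷ "0006..0101.9002.0010 ...22 0010.0103..3220 11 11 000002.3001 0001.000001.0001.30"
    ∷ ".01..0010 0020.0201.30.03.10 .11 02100070.001020.0001.2001.09 02000110..11.20 ....33"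
    ∷ "000130..0310..000011 000102..0010..301002 001020..03..1320 0001.1001.3001..000001"
    ∷ "0010.1010.0310..0221 0001.1001.30..13 11 0020.02 0006..01..9101 0060..0310.03.0320"
    ∷ "....0011 ..11 0020.02 0010.0010.000010..03 0001.3010.0110..03 0002....3001 .01..21"
    ∷ "0060.03.0320.0310 .1101.1102.30 .11 0002.01.41 ..12.32 22 ...11 ...11 .11 .11 ...11 ..33"
    ∷ "..32.0001 000001..1001..0010 .0001.3201.21 000020...0310 0010.10..000210.0001"
    ∷ "0004..30.1330 000003..200010..1001 .11..33 .0010.13.10 0001.0001.000001.30 ..101010.03"
    ∷ "0002...3001 0004.02.2020..20 22 ....33 ....33 002010...03 0011 ....11 / ...11"
    ∷ "00000002.0110.20 10.0110...01 ..0110 .1001 0002.0110..3122 0010..01.11 110001..0101.30"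
    ∷ "00000020.03...0010 0001.31..01 ...33 0010.1001...0001 .11 0010.10.10.03 01..10"
    ∷ "000101.0010.0010 100120.010101..0010 000020.000101.0110 011030.10.0201.0001 ...11"
    ∷ "...0001.0010 3101...01 11 11 .11 11 0101....31 .11 300103...10 11 .11 .11 ...11"
    ∷ "1310....10 020020..0110 ...01.100110 .11..11 .11 ....33 ..11 0030...03.0110"
    ∷ "0010..0310..10 .11 ..11 0001..31.01 2001.11..01 10....23 100010....0101 ..30..0102"
    ∷ "0010.01...3201 .0001...1110 0001.01.31 0010..01..0110 0001...31.01 0010..30..0301"
    ∷ ".11.10..01 0001..0110..10 0001.31.01 ..0001.0010 ..0110 11 .11 ...11 ...11"
    ∷ "30000003....0110 ..0101.3001 0002..0030.1101 010002...3011 10..0310..0010 0020...0310"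
    ∷ "0001..3003.10 0002.01.2010.0001.10 0010...1310 000010.0310.1010.01 0010.03.0010.10"
    ∷ "....11 ....11 11 11 0011 / 0010....0001 ..1001 1101....0010 11 ...11 ...0110 ...11 0110"
    ∷ ".11 .11 ..11 .11 0001....10 0001.0010..1001 ....11 ....11 11 ..11 000001..10..0110"
    ∷ "0010..01..0110 010010.0110 ...11 001010....0101 ....11 .11 ..11 ..01..10"
    ∷ "0001.0001...1010 001001....1001 0001..10"
    ∷ [] ) refl

  solvable-5-13 : Solvable (replicate 5 13) 12
  solvable-5-13 = solvable-certified 5 13 12
    ( "44...0=.=0 / .=0..44.0= ....44 / 0220 0208...14.=0 0020.;2.0=..20 5050.2;.=0.0=.12 /"
    ∷ "0107..49..=0 0209..=0.0002 0040...49.10 0508.000;.=0.=0.02 .2211 / 11..11 ..33 010:.<1"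
    ∷ "0008.0002.=0.13.01 ...33 0010.01 0080.021010.0=.61 1207.16..=0 / ..11 000030.=0.10.04.0="
    ∷ ".44 ..44 0008.;002...01 ...11 0070..94.0=.10 0508..=0.22 0003.0010..35.40"
    ∷ "401080.060010.94.0= 0104..94 / 0003.94..02 0003.02.94 ....44 ....44 22..44 5080..33.0="
    ∷ "5002..13..01 0010..49.01.50 0008.011001.<1.0001.0001 0040.10.49 ..33 000001.0001.31"
    ∷ "1030.06.31 / 000;.33..02.=0 0090.31..20.0= ..33 .22.11 ..11 ....22 ..22 ..22"
    ∷ "111010.29.50 10100030.0;.004031 ..11 ....11 5002..13.01 ..33 ..44 0002.01.44.30 ...11.22"
    ∷ "0001.01.31 ..33 ..11 401080.060060..0= 1001 / .11 0002...20 00;0.20.11..0= 0010..01"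
    ∷ "....11 ....11 ..11 ..11 ....22 ....22 01101004.7220.1104 100190.0902.31 .33"
    ∷ "000020.25.4003 020105.51.5001 0020...35 0010...01 ..11 0210..31..01 03.0010.10.0010"
    ∷ "0204.010001.9001 0206..9001 05..11.50 0010.01 .22 / 0040...10.49 0040.10...49 11 11 11"
    ∷ "11 100101.0010 .33 .11.0440 100106.9002.1101 ..33 .22 100020.32.0103 .32.12 010105.9101"
    ∷ "22 23...21 02....31 11 031020 002010....03 1220..0001 0311..30 11 ..33 001020..0003"
    ∷ "0002.10..0010 030020.010010..0010 0004.01..94 / 0001...01.31 ....33 0010.10...13 ....11"
    ∷ "..11 ..11 .33 ..1122 .11 .0101.31 0001.01.31 011003.3011 0001.30.0101 010030.0010.0201"
    ∷ "...11 ...11 0101...31 0320...10 11 11 001010....0310 300102 ..11 11 1010..13"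
    ∷ "010120.10..0001 ..11 ..33 .0001..1010.01 0011 22 002001.0001 ...33 0001.01..31 / ....11"
    ∷ "...11 .11 ....11 .11 011010..01 ..11 .11 000110.1001 11 ...11 11 ....11"
    ∷ [] ) refl

  solvable-5-16 : Solvable (replicate 5 16) 13
  solvable-5-16 = solvable-certified 5 16 13
    ( ".08..<4 / @0.8080.0@.44.0@ @0.08.0@.0080 / @0.0406.5; / .4003.23 .4030.38.02 / 55 ...22"
    ∷ ".0001.53.01 / 23..10 22 @0.000<.1202.01 0@.40<0.1210 / 1050....5; 0002.08..31.80"
    ∷ ".0005..01.;5 .0005.01..;5 0@.0080...80 / 0101...31 0020.08..31.51 .33 ....55"
    ∷ "@0.130:...15 .1310..10 .3101.01 08.3160 / ...11 11 0040....0510 ....33 ....33 .33 .33"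
    ∷ ".000004...5001 .11 .0010..01 .0010.01 33 55 / .11.11..22 0005.80.01.13 11 11 11 11"
    ∷ "....22 ....22 ....22 ....22 37.0030...32 80.1306 ....33 ....33 ....33 ....33 /"
    ∷ "0001.300101 0001.24.01..2020 0010.031010 .33 .33 .11 .11 ...11 ...11 11 11 11 11 33"
    ∷ "0011....11 9403.0001...01 55 33 11 .11 .11 22 22 22 22 / .11 0002....3001 .01.0010..11"
    ∷ ".13...1010 .0110.1001..11 .11 .11 .11 ...11 ...11 ...11 ....11 .11 .11 .11 .11 11"
    ∷ "13....20 33 1310....10 22 22 11 .11 ....11 11 ....11 ....11 / ....11 .0001.0010 .11"
    ∷ "..01..1110 0010.0001...1001 .11 ..11 ...11 ....11 ....11 11 11"
    ∷ [] ) refl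

  solvable-5-17 : Solvable (replicate 5 17) 13
  solvable-5-17 = solvable-certified 5 17 13
    ( "A0.66...0A / .22 .1210 / 0A.10;0.>3.>3.0A ....55 / .0004.45.1=.A0 .1004.:403.>030.0A"
    ∷ ".00?0..0A.20 0A...A0.22 / .0004.:020.2;10 .0001.12.=0.3> ...11 .00:0.0030.7003.0A"
    ∷ ".0001...10 ..0A.A0.11 / ...11.66 .00>0.20.34.1@ 65.000<...>003 5<.0060.10 .1030.37 ..11"
    ∷ "...11 .0040..37 / 37.00:0.0:40.0110 .0030.4340.0101.06 ...4411 11...11.55 44 ..11..77"
    ∷ "....11 1420..10 .10.12 A0.0009.07..56 56.0010 66 65.0001 / :0.0007.0040.0101.0005"
    ∷ "22..4411 A0.000:.17..12 74.0002.0430 .000:.01..>201 A0.0005.01..3> .0003.01..513223"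
    ∷ ".0001.01..603205 500001.0006..001010.600105 11...44.11 000060.0030.0110.0<.30 ..11"
    ∷ "3460.0010.50.1< 000<..01.=0 A0.0105...3> .0010...12 A0.000:.07..22 22 22 ..66 ..66 22"
    ∷ "22:0..0A.70 / ....22 ....22 11 200003..400002.0001.2211 ..04400011 80.000;...4001"
    ∷ "81.0008.52..02 0=40.0040.11..50 232001 81.0003...59 81.0001..0401.0210 66"
    ∷ "631010.0008..000010.5003 0?0010.0070.11.100110.302010 ....2211 701001.0008..0001.0020"
    ∷ ";00501.0001.10..0632 922310.0006.01 430010..11.000101 02000003....920101"
    ∷ "02100006...004040.45 20100020....291010 0020....0211 5001...44.04 0607...=0.11"
    ∷ "043050..05.4410 4010..05.44 0020...94.07 66 66 2080...25.18 ....66 22 22 ..22 22 ..66.22"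
    ∷ "..66 / 23..31..01 020330..31.0010.01 0050..9104.01.0305 000020....11100201"
    ∷ "01201001..000220.0001 ....110011 000005..0210.0101.6031 00010204..110010.01.6032"
    ∷ "80.0006...13 33 33 11..22..11 3=10.0080.0001..20 0010....12 020050..0011.1010.2205"
    ∷ "0010..31..03 7301.0002...23 3201 33 11..11.22 3=10.0040.10.40 22 22"
    ∷ "440004.0002..20.233020 33 33 :51010.0002.0101..031001 631010.0004.01.1001"
    ∷ "691010.0030..10.020001 2=.0090..000110.1010 ;41001..01.1110.0502 160140..20.11.1210"
    ∷ "1320..10..12 920510.0030...0303 22..11..11 00000004...02.603201 301101..11.02.22"
    ∷ "11...11.22 04301030...100101.0101 510005...0210.2110 ...33 010160...0531.0001"
    ∷ "00000040...052012 ...112211 100010...000431.00000110 1020...12.13 00000004...502102 22"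
    ∷ "120<.0001..<010.2001 2001...10.13 22 11..50.05 400003..20.03 1301..20.10 ...33"
    ∷ "0050...31.07 22 22 ..22 ..22 1080....3=10 ...22 ...22 ..22 ..22 22 ..22 01..5114"
    ∷ "0106..0060.300002 ...22 ...22 / 132020..03..10 020020....0110 50301007..0001..01"
    ∷ "200002...0001.10 03002001..11.0010.10 ..33 0050..3001..0623 002003..1010.1001.01"
    ∷ "110201..2001.1010 ..01..1330 0010..13..0010 00000020....021001 100190..04020201..0110"
    ∷ "1001..2002 ....33 112001...0001.22 301001..0010.0001.03 001060....0920 66 33 33 ..33"
    ∷ "..33 33000003..202010..0101 240101..202010..0001 33000030..020201..1010 000002..4102..10"
    ∷ "9404....01 44 110101..2010.01 11 ....22 0011....11 010107....90 33 42100101...000210"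
    ∷ "30010101 000040..01.0410 ....11 ....11 0410...200110.002001 110001....3002 11"
    ∷ "00001001....3003 42010001..0001.000010 140001..0101.100010.212010 840004...0010.01"
    ∷ "30030010...0001 240110...1010.0110 14000010.0020...010010 75020001.0001...20"
    ∷ "940003...0101 92...01.0501 000002..10..4102 00000002..10..400201 22..11"
    ∷ "00001001..0110..2002 04000020....200110 000330..0010..01 310101 ....33 00020001....4210"
    ∷ "00000001....300101 200010....241211 00020140...02.10 03101010...11"
    ∷ "12000030..10.2001.0202 00000002...0110.20 02011020...1010.020110 24010010....20 03101010"
    ∷ "...0110.2101 20111002..1001.000001 02..10.010001.4001 210101...201001.0210"
    ∷ "140010...20.000110 41100102...01 ....33 0101:0...0810.0001 20011001...01"
    ∷ "100102...0320.2010 010030...201010.3405 ...11.44 0003...124011 010003...5020.14"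
    ∷ "001050...001110.0403 011040...201101.040001 100030...0102.0430 02011010...10 1040...49"
    ∷ "...44 001050...04.02 300206...30.3001 300102 ..32.12 013003..3002 0020..0310 11"
    ∷ "..2102.0010 ....22 ....55 ....11 ....11 22 22 22 22 1002...4102 0004...01.94 ....22"
    ∷ "....22 ....22 ....22 ...11 ...11 ...11 ...11 ..13.0020 10..2201 0030..0313.0020 ..22"
    ∷ "..22 ..22 ..22 ..22 / 11 010002..30..1001 110230..0310..0010 33 33 03101010 ..01..10"
    ∷ "..11 0001..31..01 0003...1001.3330 110101..10.0010 11..11 01..1101..1010 100110....12"
    ∷ "1010....0310 11 000002....3001 011001..1210.10 ..2211 ..1111 100010..01..1101"
    ∷ "000010..1001..12 ....33 112001..0001..11 22 22 ....11 11 ..11 11 ..0011 1010..0211"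
    ∷ "120120..1001 ..0011 011010..1101 1210....11 11 101010..0101.01.1320 11 33 ....22 11"
    ∷ "000002...3001 1210...11 01..10.11 10..01.11 120010....1001 0001..01.31 ..11"
    ∷ "0002...2001.1011 1310....10 ....11 ...11 300010....0301 021020..1001.01"
    ∷ "1010..0001.01.2002 121001...0010.11 3201 031010....10 010010...0110.1001 2101...1001 33"
    ∷ "0101...1110.10 310110...02 010001...1001.3210 0010..11..12 310110....0101 130010..01..20"
    ∷ "11..0010..0001 120120..10..0001 001050....0303 031020 011002....2110 11..10..01"
    ∷ "10...1110.02 ...1101.21 ....0011 0001...01.1120 0010..0001..11 020130...1001.1001"
    ∷ "11...1001.11 0010...0001.11 11 10...11.12 010010...0001.3101 1310...10"
    ∷ "000001...001001.1110 100020...1101.010001 13....20 011030...1001.0201 ...33"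
    ∷ "0001...1110.1001 00010001...210010 000020...0310 ...31.02 0004...2030.0001"
    ∷ "000002...001001.1010 ....33 ....11 000010...0110.12 0001...01.31 1101...21 ...11 ...22"
    ∷ "0010...1101 11....11 ..11 ...0110 000003..3001.0010 3101..01 ...11 ....11 11 .11 ..11"
    ∷ "...11 ...11 ...11 11 ..20.1201 0001..3001.0001 10..01.11 ..11 ...11 / ..11 11 11"
    ∷ "1101....10 100101....0010 ....11 ....11 10..0001 010120..1001 10....01"
    ∷ "00000001...0001.001010 0010....1101 ..01.10 01..10 1110...01 01..10"
    ∷ "000110..000101.10.0010 01..10 0010..0001..1001 ..0001..10 ....0110 ..11 ..1110..0001"
    ∷ "....0110 10....01 ...11 1110...0001 ..0001.1110 100010...0101 ...11 0010...0010.0101"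
    ∷ "10...1101 101002..0010.01 ...10.01 101002...0010.01 00000110...1010.010001 01...10"
    ∷ "....11 0110 ...01.1110 ...11 000110..01.10 .11 100001"
    ∷ [] ) refl

  -- Base cases up to the largest denominator

  bounded-2 : ∀ n .{{_ : NonZero n}} → Bounded (4 ∷ []) 1 n
  bounded-2 = bounded (4 ∷ []) 1 5 (s≤s z≤n) (below ∷ [])
    ( base s1
    ∷ base (triple 1 s1)
    ∷ base (triple 1 s1)
    ∷ base solvable-2-4
    ∷ base solvable-2-5
    ∷ [] )
    where
    s1 : Solvable (replicate 2 1) 0
    s1 = solvable-unique 2 (s≤s z≤n)

  bounded-3 : ∀ n .{{_ : NonZero n}} → Bounded (3 ∷ 5 ∷ []) 2 n
  bounded-3 = bounded (3 ∷ 5 ∷ []) 2 6 (s≤s z≤n) (below ∷ below ∷ [])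
    ( base s1
    ∷ base solvable-3-2
    ∷ base (triple 1 s1)
    ∷ base solvable-3-4
    ∷ base (triple 2 solvable-3-2)
    ∷ base (triple 2 solvable-3-2)
    ∷ [] )
    where
    s1 : Solvable (replicate 3 1) 0
    s1 = solvable-unique 3 (s≤s z≤n)

  bounded-4 : ∀ n .{{_ : NonZero n}} → Bounded (4 ∷ 10 ∷ 19 ∷ []) 5 n
  bounded-4 = bounded (4 ∷ 10 ∷ 19 ∷ []) 5 20 (s≤s z≤n) (below ∷ below ∷ below ∷ [])
    ( base s1
    ∷ base solvable-4-2
    ∷ base (triple 1 s1)
    ∷ base solvable-4-4
    ∷ base solvable-4-5
    ∷ base (triple 2 solvable-4-2)
    ∷ base (triple 3 s3)
    ∷ base (triple 3 s3)
    ∷ base (triple 3 s3)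
    ∷ base solvable-4-10
    ∷ base solvable-4-11
    ∷ base (triple 5 solvable-4-5)
    ∷ base (triple 5 solvable-4-5)
    ∷ base (triple 5 solvable-4-5)
    ∷ base (triple 5 solvable-4-5)
    ∷ base (triple 6 s6)
    ∷ base (triple 6 s6)
    ∷ base (triple 6 s6)
    ∷ base solvable-4-19
    ∷ base solvable-4-20
    ∷ [] )
    where
    s1 : Solvable (replicate 4 1) 0
    s1 = solvable-unique 4 (s≤s z≤n)
    s3 : Solvable (replicate 4 3) 4
    s3 = triple 1 s1
    s6 : Solvable (replicate 4 6) 7
    s6 = triple 2 solvable-4-2

  bounded-5 : ∀ n .{{_ : NonZero n}} → Bounded (6 ∷ 10 ∷ 12 ∷ 16 ∷ []) 7 n
  bounded-5 = bounded (6 ∷ 10 ∷ 12 ∷ 16 ∷ []) 7 17 (s≤s z≤n) (below ∷ below ∷ below ∷ below ∷ [])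
    ( base s1
    ∷ base solvable-5-2
    ∷ base (triple 1 s1)
    ∷ base solvable-5-4
    ∷ base solvable-5-5
    ∷ base (triple 2 solvable-5-2)
    ∷ base solvable-5-7
    ∷ base (triple 3 s3)
    ∷ base (triple 3 s3)
    ∷ base solvable-5-10
    ∷ base solvable-5-11
    ∷ base (triple 4 solvable-5-4)
    ∷ base solvable-5-13
    ∷ base (triple 5 solvable-5-5)
    ∷ base (triple 5 solvable-5-5)
    ∷ base solvable-5-16
    ∷ base solvable-5-17
    ∷ [] )
    where
    s1 : Solvable (replicate 5 1) 0
    s1 = solvable-unique 5 (s≤s z≤n)
    s3 : Solvable (replicate 5 3) 5
    s3 = triple 1 s1

open Strategies using (bounded-2; bounded-3; bounded-4; bounded-5)
open import Data.Integer using (+_; _+_; _≤_)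
open import Data.Nat using (ℕ; NonZero)
open import Data.Product using (_×_; _,_)
open import Data.Vec using (replicate)

proposition1 : (n : ℕ) .{{_ : NonZero n}} →
    (+ g₁ (replicate 2 n) ≤ ⌈log₃ n / 1 ⌉ + ⌈log₃ n / 5 ⌉ + + 1)
    × (+ g₁ (replicate 3 n) ≤ ⌈log₃ n / 1 ⌉ + ⌈log₃ n / 4 ⌉ + ⌈log₃ n / 6 ⌉ + + 2)
    × (+ g₁ (replicate 4 n) ≤ ⌈log₃ n / 1 ⌉ + ⌈log₃ n / 5 ⌉ + ⌈log₃ n / 11 ⌉ + ⌈log₃ n / 20 ⌉ + + 5)
    × (+ g₁ (replicate 5 n) ≤ ⌈log₃ n / 1 ⌉ + ⌈log₃ n / 7 ⌉ + ⌈log₃ n / 11 ⌉ + ⌈log₃ n / 13 ⌉ + ⌈log₃ n / 17 ⌉ + + 7)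
proposition1 n = bounded-2 n , bounded-3 n , bounded-4 n , bounded-5 n
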